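{- Let $f$ be a function on isomorphism classes of binary delta-matroids with values in a complex vector space, satisfying the four-term relation $$f(D)-f(D'_{ab})=f(\widetilde D_{ab})-f\big((\widetilde D_{ab})'_{ab}\big)$$ for every binary delta-matroid $D=(E;\Phi)$ and every pair of distinct $a,b\in E$. Then the function $g(\Gamma)=f(D(\Gamma))$ on embedded graphs satisfies the four-term relation for embedded graphs, i.e. is a weight system: for every embedded graph $\Gamma$ and every pair of distinct edges $a,b$ of $\Gamma$ having neighboring ends at some vertex, $$g(\Gamma)-g(\Gamma'_{ab})=g(\widetilde\Gamma_{ab})-g\big((\widetilde\Gamma_{ab})'_{ab}\big).$$
   Context: Set system $(E;\Phi)$: finite $E$, nonempty $\Phi\subseteq2^E$, up to isomorphism. Twist $D*E'=(E;\{\phi\Delta E'\})$. A binary delta-matroid is a set system isomorphic to a twist of the nondegeneracy delta-matroid of a framed graph (simple graph with framing $V\to\{0,1\}$, $\mathbb{F}_2$-adjacency matrix with the framing on the diagonal; feasible sets are vertex subsets with nondegenerate induced adjacency matrix over $\mathbb{F}_2$, including $\emptyset$). Sliding: $\widetilde D_{ab}=(E;\Phi\,\Delta\,\{\phi\sqcup\{a\}\mid\phi\subseteq E\setminus\{a,b\},\ \phi\sqcup\{b\}\in\Phi\})$; exchange: $D'_{ab}=\big(\widetilde{(D*\{b\})}_{ab}\big)*\{b\}$. An embedded graph is a connected graph cellularly embedded in a compact (possibly nonorientable) surface; its delta-matroid $D(\Gamma)$ has ground set the edge set, with $\phi$ feasible iff the spanning ribbon subgraph with edge set $\phi$ has connected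 boundary; $D(\Gamma)$ is binary. For edges $a\ne b$ having neighboring ends at a vertex, $\Gamma'_{ab}$ is obtained by exchanging these two neighboring ends (first Vassiliev move), and $\widetilde\Gamma_{ab}$ is obtained by sliding the end of $a$ neighboring $b$ along the ribbon $b$ to the other end of $b$ (handle sliding, second Vassiliev move). -}

module Defs where

open import Level using (Level; 0ℓ)
open import Algebra.Bundles using (CommutativeRing)
open import Algebra.Module.Bundles using (Module)
import Algebra.Properties.Semiring.Sum as SemiringSum
open import Data.Bool using (Bool; true; false; not; _∧_; _xor_; if_then_else_)
import Data.Bool.Properties as Bool
open import Data.Fin using (Fin)
import Data.Fin.Properties as Fin
open import Data.Fin.Permutation using (Permutation; _⟨$⟩ʳ_)
open import Data.Fin.Subset using (Subset; ⁅_⁆; _∈_; _⊆_; inside; outside) renaming (⊥ to ∅)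
open import Data.Fin.Subset.Properties using (_∈?_; _⊆?_; anySubset?)
open import Data.List using (List; []; _∷_; cartesianProduct; allFin)
open import Data.List.Membership.Propositional renaming (_∈_ to _∈ˡ_)
open import Data.List.Membership.Propositional.Properties using (∈-allFin; ∈-cartesianProduct⁺)
open import Data.List.Relation.Unary.Any using (here; there)
open import Data.Nat using (ℕ)
open import Data.Product using (Σ; ∃; _×_; _,_; proj₁; proj₂)
open import Data.Product.Properties using () renaming (≡-dec to ×-≡-dec)
open import Data.Sum using (_⊎_; inj₁; inj₂)
open import Data.Vec using (lookup; tabulate; zipWith; _[_]≔_)
open import Data.Vec.Properties using () renaming (≡-dec to Vec-≡-dec)
open import Function using (_∘_)
open import Relation.Binary using (Rel; Decidable; DecidableEquality)
open import Relation.Binary.Construct.Closure.ReflexiveTransitive using (Star; ε; _◅_; _◅◅_)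
open import Relation.Binary.PropositionalEquality
  using (_≡_; _≢_; refl; sym; trans; cong; subst; ≢-sym; module ≡-Reasoning)
open import Relation.Nullary using (¬_; Dec; yes; no; does; contradiction; ¬?)
open import Relation.Nullary.Decidable
  using (map′; _×-dec_; _⊎-dec_; _→-dec_; decidable-stable; dec-true; dec-false)

------------------------------------------------------------------------
-- Set systems

-- The ground set is E = Fin size; Φ is given by its characteristic
-- function.  That Φ is inhabited is the separate predicate Nonempty.
record SetSystem : Set where
  field
    size     : ℕ
    feasible : Subset size → Bool

open SetSystem public

Nonempty : SetSystem → Set
Nonempty D = ∃ λ φ → feasible D φ ≡ true

infix 4 _≅_

-- φ ⊆ E′ is feasible iff its preimage under the bijection E → E′ is.
_≅_ : SetSystem → SetSystem → Set
D ≅ D′ = Σ (Permutation (size D) (size D′)) λ σ →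
  ∀ φ → feasible D′ φ ≡ feasible D (tabulate λ e → lookup φ (σ ⟨$⟩ʳ e))

infixl 6 _△_

_△_ : ∀ {n} → Subset n → Subset n → Subset n
_△_ = zipWith _xor_

-- φ = (φ △ A) △ A is feasible in D * A iff φ △ A is feasible in D.
twist : (D : SetSystem) → Subset (size D) → SetSystem
twist D A = record { size = size D ; feasible = λ φ → feasible D (φ △ A) }

-- A set is of the form ψ ⊔ {a}, with ψ ⊆ E ∖ {a , b} and ψ ⊔ {b} ∈ Φ, iff it
-- contains a, does not contain b, and becomes feasible on replacing a by b.
-- Only meant for a ≢ b.
slide : (D : SetSystem) (a b : Fin (size D)) → SetSystem
slide D a b = record
  { size     = size D
  ; feasible = λ φ →
      feasible D φ xor
      (lookup φ a ∧ not (lookup φ b) ∧ feasible D (φ [ a ]≔ outside [ b ]≔ inside))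
  }

exchange : (D : SetSystem) (a b : Fin (size D)) → SetSystem
exchange D a b = twist (slide (twist D ⁅ b ⁆) a b) ⁅ b ⁆

------------------------------------------------------------------------
-- Framed graphs and binary delta-matroids

record FramedGraph : Set where
  field
    order       : ℕ
    adjacent    : Fin order → Fin order → Bool
    symmetric   : ∀ u v → adjacent u v ≡ adjacent v u
    irreflexive : ∀ v → adjacent v v ≡ false
    framing     : Fin order → Bool

open FramedGraph public

-- 𝔽₂ is Bool with addition _xor_ and multiplication _∧_.
𝔽₂ : CommutativeRing 0ℓ 0ℓ
𝔽₂ = Bool.xor-∧-commutativeRing

open SemiringSum (CommutativeRing.semiring 𝔽₂) public using () renaming (sum to sum₂)

Matrix₂ : ℕ → Set
Matrix₂ n = Fin n → Fin n → Bool

adjacencyMatrix : (G : FramedGraph) → Matrix₂ (order G)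
adjacencyMatrix G u v = if does (u Fin.≟ v) then framing G u else adjacent G u v

-- The submatrix of A with rows and columns in S has trivial kernel.  A vector
-- of 𝔽₂^S is represented by its support x ⊆ S.
Nondegenerate : ∀ {n} → Matrix₂ n → Subset n → Set
Nondegenerate A S = ∀ x → x ⊆ S →
  (∀ u → u ∈ S → sum₂ (λ v → A u v ∧ lookup x v) ≡ false) → x ≡ ∅

allSubset? : ∀ {n p} {P : Subset n → Set p} → (∀ x → Dec (P x)) → Dec (∀ x → P x)
allSubset? P? = map′
  (λ ¬∃¬ x → decidable-stable (P? x) λ ¬p → ¬∃¬ (x , ¬p))
  (λ ∀P (x , ¬p) → ¬p (∀P x))
  (¬? (anySubset? λ x → ¬? (P? x)))

nondegenerate? : ∀ {n} (A : Matrix₂ n) S → Dec (Nondegenerate A S)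
nondegenerate? A S = allSubset? λ x →
  (x ⊆? S) →-dec
  (Fin.all? λ u → (u ∈? S) →-dec (sum₂ (λ v → A u v ∧ lookup x v) Bool.≟ false)) →-dec
  Vec-≡-dec Bool._≟_ x ∅

nondegeneracy : FramedGraph → SetSystem
nondegeneracy G = record
  { size     = order G
  ; feasible = λ S → does (nondegenerate? (adjacencyMatrix G) S)
  }

IsBinary : SetSystem → Set
IsBinary D = Nonempty D ×
  Σ FramedGraph λ G → Σ (Subset (order G)) λ A → D ≅ twist (nondegeneracy G) A

BinaryDeltaMatroid : Set
BinaryDeltaMatroid = Σ SetSystem IsBinary

------------------------------------------------------------------------
-- Decidability of reachability on a finite set

module Reachability {A : Set} (_≟_ : DecidableEquality A)
                    {R : Rel A 0ℓ} (R? : Decidable R) where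

  -- Paths all of whose intermediate points lie in the list.
  Via : List A → Rel A 0ℓ
  Via []       p q = p ≡ q ⊎ R p q
  Via (x ∷ xs) p q = Via xs p q ⊎ (Via xs p x × Via xs x q)

  via? : ∀ xs → Decidable (Via xs)
  via? []       p q = (p ≟ q) ⊎-dec R? p q
  via? (x ∷ xs) p q = via? xs p q ⊎-dec (via? xs p x ×-dec via? xs x q)

  via⇒star : ∀ xs {p q} → Via xs p q → Star R p q
  via⇒star []       (inj₁ refl)    = ε
  via⇒star []       (inj₂ r)       = r ◅ ε
  via⇒star (x ∷ xs) (inj₁ v)       = via⇒star xs v
  via⇒star (x ∷ xs) (inj₂ (v , w)) = via⇒star xs v ◅◅ via⇒star xs w

  base⇒via : ∀ xs {p q} → p ≡ q ⊎ R p q → Via xs p q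
  base⇒via []       r = r
  base⇒via (x ∷ xs) r = inj₁ (base⇒via xs r)

  via-trans : ∀ {xs m p q} → m ∈ˡ xs → Via xs p m → Via xs m q → Via xs p q
  via-trans (here refl) v w = inj₂ (to v , from w)
    where
    to : ∀ {x xs p} → Via (x ∷ xs) p x → Via xs p x
    to (inj₁ v)       = v
    to (inj₂ (v , _)) = v
    from : ∀ {x xs q} → Via (x ∷ xs) x q → Via xs x q
    from (inj₁ w)       = w
    from (inj₂ (_ , w)) = w
  via-trans (there m∈) (inj₁ v)       (inj₁ w)       = inj₁ (via-trans m∈ v w)
  via-trans (there m∈) (inj₁ v)       (inj₂ (w , y)) = inj₂ (via-trans m∈ v w , y)
  via-trans (there m∈) (inj₂ (u , v)) (inj₁ w)       = inj₂ (u , via-trans m∈ v w)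
  via-trans (there m∈) (inj₂ (u , _)) (inj₂ (_ , y)) = inj₂ (u , y)

  star? : (xs : List A) → (∀ x → x ∈ˡ xs) → Decidable (Star R)
  star? xs complete p q = map′ (via⇒star xs) star⇒via (via? xs p q)
    where
    star⇒via : ∀ {p q} → Star R p q → Via xs p q
    star⇒via ε       = base⇒via xs (inj₁ refl)
    star⇒via (r ◅ s) = via-trans (complete _) (base⇒via xs (inj₂ r)) (star⇒via s)

------------------------------------------------------------------------
-- Embedded graphs

-- A graph cellularly embedded in a compact surface is encoded as a ribbon
-- graph.  The ribbon of an edge e is a rectangle with corners, or flags,
-- (e , i , s), where i is one of the two ends of the ribbon (the segments glued
-- to vertex discs) and s one of its two sides.  The labels i and s carry no
-- geometric meaning: changing them gives a homeomorphic ribbon graph.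
Flag : ℕ → Set
Flag n = Fin n × Bool × Bool

edge : ∀ {n} → Flag n → Fin n
edge = proj₁

acrossEnd alongSide : ∀ {n} → Flag n → Flag n
acrossEnd (e , i , s) = e , i , not s
alongSide (e , i , s) = e , not i , s

-- The boundary of a vertex disc alternates between ribbon ends and free arcs;
-- corner pairs up the two endpoints of every free arc.  Vertices are thus the
-- orbits of corner and acrossEnd.  Any fixed-point free involution is allowed,
-- so twisted ribbons (nonorientable surfaces) are included.
--
-- A connected graph has no isolated vertices unless it is a single vertex
-- without edges; that graph, embedded in the sphere, is the case #edges ≡ 0.
GraphStep : ∀ {n} → (Flag n → Flag n) → Rel (Flag n) 0ℓ
GraphStep corner p q = q ≡ corner p ⊎ q ≡ acrossEnd p ⊎ q ≡ alongSide p

record EmbeddedGraph : Set where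
  field
    #edges     : ℕ
    corner     : Flag #edges → Flag #edges
    involutive : ∀ p → corner (corner p) ≡ p
    fixfree    : ∀ p → corner p ≢ p
    connected  : ∀ p q → Star (GraphStep corner) p q

open EmbeddedGraph public

-- The boundary of the spanning ribbon subgraph with edge set φ follows the free
-- arcs, the sides of the ribbons in φ, and the ends of the ribbons not in φ.
follow : ∀ {n} → Subset n → Flag n → Flag n
follow φ p = if lookup φ (edge p) then alongSide p else acrossEnd p

BoundaryStep : (Γ : EmbeddedGraph) → Subset (#edges Γ) → Rel (Flag (#edges Γ)) 0ℓ
BoundaryStep Γ φ p q = q ≡ corner Γ p ⊎ q ≡ follow φ p

-- If #edges ≡ 0, there are no flags and the boundary, a single circle, is indeed
-- connected.
ConnectedBoundary : (Γ : EmbeddedGraph) → Subset (#edges Γ) → Set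
ConnectedBoundary Γ φ = ∀ p q → Star (BoundaryStep Γ φ) p q

infix 4 _≟ᶠ_

_≟ᶠ_ : ∀ {n} → DecidableEquality (Flag n)
_≟ᶠ_ = ×-≡-dec Fin._≟_ (×-≡-dec Bool._≟_ Bool._≟_)

allBool : List Bool
allBool = false ∷ true ∷ []

∈-allBool : ∀ b → b ∈ˡ allBool
∈-allBool false = here refl
∈-allBool true  = there (here refl)

allFlags : ∀ n → List (Flag n)
allFlags n = cartesianProduct (allFin n) (cartesianProduct allBool allBool)

∈-allFlags : ∀ {n} (p : Flag n) → p ∈ˡ allFlags n
∈-allFlags (e , i , s) =
  ∈-cartesianProduct⁺ (∈-allFin e) (∈-cartesianProduct⁺ (∈-allBool i) (∈-allBool s))

allFlag? : ∀ {n ℓ} {P : Flag n → Set ℓ} → (∀ p → Dec (P p)) → Dec (∀ p → P p)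
allFlag? P? = map′
  (λ { h (e , false , false) → proj₁ (proj₁ (h e))
     ; h (e , false , true ) → proj₂ (proj₁ (h e))
     ; h (e , true  , false) → proj₁ (proj₂ (h e))
     ; h (e , true  , true ) → proj₂ (proj₂ (h e)) })
  (λ h e → (h _ , h _) , (h _ , h _))
  (Fin.all? λ e →
    (P? (e , false , false) ×-dec P? (e , false , true)) ×-dec
    (P? (e , true  , false) ×-dec P? (e , true  , true)))

connectedBoundary? : ∀ Γ φ → Dec (ConnectedBoundary Γ φ)
connectedBoundary? Γ φ = allFlag? λ p → allFlag? λ q →
  Reachability.star? _≟ᶠ_ step? (allFlags _) ∈-allFlags p q
  where
  step? : Decidable (BoundaryStep Γ φ)
  step? p q = (q ≟ᶠ corner Γ p) ⊎-dec (q ≟ᶠ follow φ p)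

deltaMatroid : EmbeddedGraph → SetSystem
deltaMatroid Γ = record
  { size     = #edges Γ
  ; feasible = λ φ → does (connectedBoundary? Γ φ)
  }

------------------------------------------------------------------------
-- Vassiliev moves

-- The end endᵃ of a and the end endᵇ of b are consecutive on the boundary of a
-- vertex disc: a free arc joins the corner of a's end on side sideᵃ to the
-- corner of b's end on side sideᵇ.
record NeighbouringEnds (Γ : EmbeddedGraph) (a b : Fin (#edges Γ)) : Set where
  field
    endᵃ sideᵃ endᵇ sideᵇ : Bool
    consecutive : corner Γ (a , endᵃ , sideᵃ) ≡ (b , endᵇ , sideᵇ)

swap : ∀ {n} → Flag n → Flag n → Flag n → Flag n
swap p q r = if does (r ≟ᶠ p) then q else if does (r ≟ᶠ q) then p else r

swap-left : ∀ {n} (p q : Flag n) → swap p q p ≡ q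
swap-left p q rewrite dec-true (p ≟ᶠ p) refl = refl

swap-right : ∀ {n} (p q : Flag n) → swap p q q ≡ p
swap-right p q with q ≟ᶠ p
... | yes q≡p = q≡p
... | no  _ rewrite dec-true (q ≟ᶠ q) refl = refl

swap-other : ∀ {n} (p q : Flag n) {r} → r ≢ p → r ≢ q → swap p q r ≡ r
swap-other p q {r} r≢p r≢q
  rewrite dec-false (r ≟ᶠ p) r≢p | dec-false (r ≟ᶠ q) r≢q = refl

-- Conjugates corner by π = (x₀ y₀) (x₁ y₁): a free arc that ended at x₀ ends at
-- y₀ and vice versa, and likewise for x₁ and y₁.  The flags x₀ , x₁ belong to one
-- edge and y₀ , y₁ to another.
module Reglue (Γ : EmbeddedGraph) {x₀ x₁ y₀ y₁ : Flag (#edges Γ)}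
              (x₀≢x₁ : x₀ ≢ x₁) (y₀≢y₁ : y₀ ≢ y₁)
              (a : edge x₀ ≡ edge x₁) (b : edge y₀ ≡ edge y₁)
              (a≢b : edge x₀ ≢ edge y₀) where

  π : Flag (#edges Γ) → Flag (#edges Γ)
  π = swap x₀ y₀ ∘ swap x₁ y₁

  private
    x₀≢y₀ : x₀ ≢ y₀
    x₀≢y₀ e = a≢b (cong edge e)
    x₀≢y₁ : x₀ ≢ y₁
    x₀≢y₁ e = a≢b (trans (cong edge e) (sym b))
    x₁≢y₀ : x₁ ≢ y₀
    x₁≢y₀ e = a≢b (trans a (cong edge e))

  π-x₀ : π x₀ ≡ y₀
  π-x₀ = trans (cong (swap x₀ y₀) (swap-other x₁ y₁ x₀≢x₁ x₀≢y₁)) (swap-left x₀ y₀)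

  π-y₀ : π y₀ ≡ x₀
  π-y₀ = trans (cong (swap x₀ y₀) (swap-other x₁ y₁ (≢-sym x₁≢y₀) y₀≢y₁)) (swap-right x₀ y₀)

  π-x₁ : π x₁ ≡ y₁
  π-x₁ = trans (cong (swap x₀ y₀) (swap-left x₁ y₁))
               (swap-other x₀ y₀ (≢-sym x₀≢y₁) (≢-sym y₀≢y₁))

  π-y₁ : π y₁ ≡ x₁
  π-y₁ = trans (cong (swap x₀ y₀) (swap-right x₁ y₁))
               (swap-other x₀ y₀ (≢-sym x₀≢x₁) x₁≢y₀)

  data Position (p : Flag (#edges Γ)) : Set where
    at-x₀ : p ≡ x₀ → Position p
    at-y₀ : p ≡ y₀ → Position p
    at-x₁ : p ≡ x₁ → Position p
    at-y₁ : p ≡ y₁ → Position p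
    away  : π p ≡ p → Position p

  position : ∀ p → Position p
  position p with p ≟ᶠ x₀ | p ≟ᶠ y₀ | p ≟ᶠ x₁ | p ≟ᶠ y₁
  ... | yes e | _     | _     | _     = at-x₀ e
  ... | no _  | yes e | _     | _     = at-y₀ e
  ... | no _  | no _  | yes e | _     = at-x₁ e
  ... | no _  | no _  | no _  | yes e = at-y₁ e
  ... | no k  | no l  | no m  | no n  =
    away (trans (cong (swap x₀ y₀) (swap-other x₁ y₁ m n)) (swap-other x₀ y₀ k l))

  π-involutive : ∀ p → π (π p) ≡ p
  π-involutive p with position p
  ... | at-x₀ refl = trans (cong π π-x₀) π-y₀
  ... | at-y₀ refl = trans (cong π π-y₀) π-x₀
  ... | at-x₁ refl = trans (cong π π-x₁) π-y₁
  ... | at-y₁ refl = trans (cong π π-y₁) π-x₁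
  ... | away e     = trans (cong π e) e

  corner′ : Flag (#edges Γ) → Flag (#edges Γ)
  corner′ = π ∘ corner Γ ∘ π

  involutive′ : ∀ p → corner′ (corner′ p) ≡ p
  involutive′ p = begin
    π (corner Γ (π (π (corner Γ (π p))))) ≡⟨ cong (π ∘ corner Γ) (π-involutive _) ⟩
    π (corner Γ (corner Γ (π p)))         ≡⟨ cong π (involutive Γ _) ⟩
    π (π p)                               ≡⟨ π-involutive p ⟩
    p                                     ∎
    where open ≡-Reasoning

  fixfree′ : ∀ p → corner′ p ≢ p
  fixfree′ p e = fixfree Γ (π p) (trans (sym (π-involutive _)) (cong π e))

  private
    _⇝_ : Rel (Flag (#edges Γ)) 0ℓ
    _⇝_ = Star (GraphStep corner′)

    end⇝ : ∀ p → p ⇝ acrossEnd p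
    end⇝ p = inj₂ (inj₁ refl) ◅ ε

    side⇝ : ∀ p → p ⇝ alongSide p
    side⇝ p = inj₂ (inj₂ refl) ◅ ε

    bool-cases : (u v : Bool) → u ≡ v ⊎ u ≡ not v
    bool-cases false false = inj₁ refl
    bool-cases false true  = inj₂ refl
    bool-cases true  false = inj₂ refl
    bool-cases true  true  = inj₁ refl

    sameEdge : ∀ p q → edge p ≡ edge q → p ⇝ q
    sameEdge (e , i , s) (.e , j , t) refl with bool-cases j i | bool-cases t s
    ... | inj₁ refl | inj₁ refl = ε
    ... | inj₁ refl | inj₂ refl = end⇝ _
    ... | inj₂ refl | inj₁ refl = side⇝ _
    ... | inj₂ refl | inj₂ refl = end⇝ _ ◅◅ side⇝ _

  module _ (arc : corner Γ x₁ ≡ y₀) where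

    corner′-y₁ : corner′ y₁ ≡ x₀
    corner′-y₁ = trans (cong (π ∘ corner Γ) π-y₁) (trans (cong π arc) π-y₀)

    corner′-x₀ : corner′ x₀ ≡ y₁
    corner′-x₀ = trans (cong corner′ (sym corner′-y₁)) (involutive′ y₁)

    private
      x⇝y : ∀ {p q} → edge p ≡ edge x₀ → edge q ≡ edge y₀ → p ⇝ q
      x⇝y e f = sameEdge _ _ e ◅◅ (inj₁ (sym corner′-x₀) ◅ sameEdge _ _ (sym (trans f b)))

      y⇝x : ∀ {p q} → edge p ≡ edge y₀ → edge q ≡ edge x₀ → p ⇝ q
      y⇝x e f = sameEdge _ _ (trans e b) ◅◅ (inj₁ (sym corner′-y₁) ◅ sameEdge _ _ (sym f))

      π⇝ : ∀ p → p ⇝ π p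
      π⇝ p with position p
      ... | at-x₀ refl = subst (x₀ ⇝_) (sym π-x₀) (x⇝y refl refl)
      ... | at-y₀ refl = subst (y₀ ⇝_) (sym π-y₀) (y⇝x refl refl)
      ... | at-x₁ refl = subst (x₁ ⇝_) (sym π-x₁) (x⇝y (sym a) (sym b))
      ... | at-y₁ refl = subst (y₁ ⇝_) (sym π-y₁) (y⇝x (sym b) (sym a))
      ... | away e     = subst (p ⇝_) (sym e) ε

      step⇝ : ∀ {p q} → GraphStep (corner Γ) p q → p ⇝ q
      step⇝ {p} (inj₁ refl) =
        π⇝ p ◅◅ (inj₁ refl ◅ subst (corner′ (π p) ⇝_) eq (π⇝ (corner′ (π p))))
        where
        eq : π (corner′ (π p)) ≡ corner Γ p
        eq = trans (π-involutive _) (cong (corner Γ) (π-involutive p))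
      step⇝ (inj₂ (inj₁ refl)) = end⇝ _
      step⇝ (inj₂ (inj₂ refl)) = side⇝ _

      star⇝ : ∀ {p q} → Star (GraphStep (corner Γ)) p q → p ⇝ q
      star⇝ ε       = ε
      star⇝ (r ◅ s) = step⇝ r ◅◅ star⇝ s

    graph : EmbeddedGraph
    graph = record
      { #edges     = #edges Γ
      ; corner     = corner′
      ; involutive = involutive′
      ; fixfree    = fixfree′
      ; connected  = λ p q → star⇝ (connected Γ p q)
      }

module _ (Γ : EmbeddedGraph) {a b : Fin (#edges Γ)} (a≢b : a ≢ b)
         (N : NeighbouringEnds Γ a b) where

  open NeighbouringEnds N
    renaming (endᵃ to i; sideᵃ to s; endᵇ to j; sideᵇ to t)

  private
    side-≢ : ∀ {n} (p : Flag n) → acrossEnd p ≢ p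
    side-≢ p eq = Bool.not-¬ refl (sym (cong (proj₂ ∘ proj₂) eq))

    end-≢ : ∀ {n} (p : Flag n) → alongSide p ≢ p
    end-≢ p eq = Bool.not-¬ refl (sym (cong (proj₁ ∘ proj₂) eq))

    module Exchange = Reglue Γ {a , i , not s} {a , i , s} {b , j , t} {b , j , not t}
      (side-≢ (a , i , s)) (≢-sym (side-≢ (b , j , t))) refl refl a≢b

    module Slide = Reglue Γ {a , i , not s} {a , i , s} {b , j , t} {b , not j , t}
      (side-≢ (a , i , s)) (≢-sym (end-≢ (b , j , t))) refl refl a≢b

  -- The boundary of the vertex disc passes
  --   … (a , i , not s) (a , i , s) (b , j , t) (b , j , not t) …
  -- before the move and
  --   … (b , j , t) (b , j , not t) (a , i , not s) (a , i , s) …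
  -- after it, i.e. the free arcs are reglued along
  --   (a , i , not s) ↔ (b , j , t)  and  (a , i , s) ↔ (b , j , not t).
  exchangeEnds : EmbeddedGraph
  exchangeEnds = Exchange.graph consecutive

  -- The end of a is moved along the side t of b.  Let w = (b , not j , t), and
  -- let z be the flag joined to w by a free arc.  The boundary of the union of
  -- the vertex discs and the ribbon b passes
  --   … (a , i , not s) (a , i , s) (b , j , t) w z …
  -- before the move and
  --   … (b , j , t) w (a , i , not s) (a , i , s) z …
  -- after it, i.e. the free arcs are reglued along
  --   (a , i , not s) ↔ (b , j , t)  and  (a , i , s) ↔ (b , not j , t).
  handleSlide : EmbeddedGraph
  handleSlide = Slide.graph consecutive

  -- After the slide, the moved end of a neighbours the other end of b.
  slidEnds : NeighbouringEnds handleSlide a b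
  slidEnds = record
    { endᵃ = i ; sideᵃ = not s ; endᵇ = not j ; sideᵇ = t
    ; consecutive = Slide.corner′-x₀ consecutive
    }

------------------------------------------------------------------------
-- Four-term relations, for functions with values in a module V over a
-- commutative ring K

module FourTerm {k ℓk v ℓv : Level} {K : CommutativeRing k ℓk} (V : Module K v ℓv) where

  open Module V

  infixl 6 _-ᴹ_

  _-ᴹ_ : Carrierᴹ → Carrierᴹ → Carrierᴹ
  x -ᴹ y = x +ᴹ (-ᴹ y)

  IsomorphismInvariant : (BinaryDeltaMatroid → Carrierᴹ) → Set ℓv
  IsomorphismInvariant f = ∀ D D′ → proj₁ D ≅ proj₁ D′ → f D ≈ᴹ f D′

  -- Slides and exchanges of binary delta-matroids are again binary; the last
  -- three assumptions only serve to make f applicable to them.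
  FourTermDM : (BinaryDeltaMatroid → Carrierᴹ) → Set ℓv
  FourTermDM f = ∀ (D : SetSystem) (a b : Fin (size D)) → a ≢ b →
    (β   : IsBinary D)
    (β′  : IsBinary (exchange D a b))
    (β~  : IsBinary (slide D a b))
    (β~′ : IsBinary (exchange (slide D a b) a b)) →
    f (D , β) -ᴹ f (exchange D a b , β′) ≈ᴹ
    f (slide D a b , β~) -ᴹ f (exchange (slide D a b) a b , β~′)

  FourTermEG : (EmbeddedGraph → Carrierᴹ) → Set ℓv
  FourTermEG g = ∀ (Γ : EmbeddedGraph) (a b : Fin (#edges Γ)) (a≢b : a ≢ b)
    (N : NeighbouringEnds Γ a b) →
    let Γ~ = handleSlide Γ a≢b N
        N~ = slidEnds Γ a≢b N
    in g Γ -ᴹ g (exchangeEnds Γ a≢b N) ≈ᴹ g Γ~ -ᴹ g (exchangeEnds Γ~ a≢b N~)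

{-# OPTIONS --safe #-}
-- The boundary of the ribbon subgraph with edge set φ consists of the cycles of two
-- involutions of the flags: corner, and follow φ.
--
-- D(Γ) is binary.  If A is a quasi-tree (its boundary is a single cycle), a function on
-- the flags invariant under corner is determined up to a constant by its jumps x_e across
-- the edges e.  Invariance under follow φ means that x is supported in S = φ △ A and lies
-- in the kernel of M[S], where M_{uv} is the parity of the jumps across v met, along the
-- cycle, between two flags of u that are joined only if u ∈ S.  So the boundary of φ is
-- connected iff M[S] is nondegenerate.
--
-- D of a slide is the slide of D.  All edges except a and b enter the boundary only
-- through the matching of the eight flags of a and b by boundary paths (and the presence
-- of components that miss these flags), so the relation is reduced to the fifteen
-- matchings of eight points that contain the free arc between the neighbouring ends.
-- The exchange is the slide in the partial dual with respect to b.

module Submission where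

open import Defs
open import Level using (Level; 0ℓ)
open import Algebra.Bundles using (CommutativeRing)
open import Algebra.Module.Bundles using (Module)
open import Data.Bool using (Bool; true; false; not; _∧_; _∨_; _xor_; if_then_else_)
import Data.Bool.Properties as Bool
open import Data.Bool.Solver using (module xor-∧-Solver)
open import Data.Fin using (Fin; zero; suc; toℕ; combine)
open import Data.Fin.Permutation as Permutation using (Permutation; _⟨$⟩ʳ_)
import Data.Fin.Properties as Fin
open import Data.Fin.Subset using (Subset; _∈_; _⊆_; ⁅_⁆; inside; outside) renaming (⊥ to ∅)
open import Data.Fin.Subset.Properties using (x∈⁅x⁆; x∈⁅y⁆⇒x≡y)
open import Data.List using (List; []; _∷_; _++_; map; cartesianProduct; allFin; tabulate)
open import Data.List.Membership.DecPropositional (_≟ᶠ_ {2}) using () renaming (_∈?_ to _∈ˡ?_)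
open import Data.List.Membership.Propositional using (find; lose) renaming (_∈_ to _∈ˡ_)
open import Data.List.Membership.Propositional.Properties using (∈-allFin)
open import Data.List.Relation.Unary.All as All using (All; []; _∷_; all?)
open import Data.List.Relation.Unary.AllPairs using ([]; _∷_)
open import Data.List.Relation.Unary.Any using (here; there; any?)
open import Data.List.Relation.Unary.Unique.Propositional using (Unique)
open import Data.List.Relation.Unary.Unique.Propositional.Properties using (cartesianProduct⁺; allFin⁺)
open import Data.Nat using (ℕ; zero; suc; _+_; _*_; _<_; z<s; s<s)
import Data.Nat.Properties as ℕ
open import Data.Product using (Σ; ∃; _×_; _,_; proj₁; proj₂)
open import Data.Sum using (_⊎_; inj₁; inj₂)
open import Data.Vec as Vec using (lookup; []; _∷_; _[_]≔_)
open import Data.Vec.Properties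
  using (lookup∘tabulate; tabulate∘lookup; tabulate-cong; lookup-replicate; lookup-zipWith;
         lookup∘update; lookup∘update′; lookup⇒[]=; []=⇒lookup)
open import Function using (_∘_; _⇔_; mk⇔; Equivalence; Inverse)
open import Function.Construct.Composition using (_⇔-∘_)
open import Relation.Binary using (Rel; Decidable; DecidableEquality)
open import Relation.Binary.Construct.Closure.ReflexiveTransitive using (Star; ε; _◅_; _◅◅_; reverse)
open import Relation.Binary.PropositionalEquality
  using (_≡_; _≢_; refl; sym; trans; cong; cong₂; subst; subst₂; ≢-sym; module ≡-Reasoning)
open import Relation.Nullary using (¬_; Dec; yes; no; does; contradiction; ¬?)
open import Relation.Nullary.Decidable
  using (_×-dec_; _⊎-dec_; _→-dec_; map′; toWitness; dec-true; dec-false; does-⇔)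

private variable
  X Y : Set
  n : ℕ

-- Cycles and paths of two involutions

SelfInverse : {X : Set} → (X → X) → Set
SelfInverse f = ∀ x → f (f x) ≡ x

Step : {X : Set} → (X → X) → (X → X) → Rel X 0ℓ
Step c d p q = q ≡ c p ⊎ q ≡ d p

Reach : {X : Set} → (X → X) → (X → X) → Rel X 0ℓ
Reach c d = Star (Step c d)

module _ {X : Set} {c d : X → X} where

  c-step : ∀ {p} → Reach c d p (c p)
  c-step = inj₁ refl ◅ ε

  d-step : ∀ {p} → Reach c d p (d p)
  d-step = inj₂ refl ◅ ε

  reach-sym : SelfInverse c → SelfInverse d → ∀ {p q} → Reach c d p q → Reach c d q p
  reach-sym cc dd = reverse λ where
    (inj₁ refl) → inj₁ (sym (cc _))
    (inj₂ refl) → inj₂ (sym (dd _))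

  reach-closed : (P : X → Set) → (∀ p → P p → P (c p)) → (∀ p → P p → P (d p)) →
                 ∀ {p q} → Reach c d p q → P p → P q
  reach-closed P Pc Pd ε                 h = h
  reach-closed P Pc Pd (inj₁ refl ◅ s) h = reach-closed P Pc Pd s (Pc _ h)
  reach-closed P Pc Pd (inj₂ refl ◅ s) h = reach-closed P Pc Pd s (Pd _ h)

reach-map : {X Y : Set} {c d : X → X} {c′ d′ : Y → Y} (f : X → Y) →
            (∀ p → Reach c′ d′ (f p) (f (c p))) → (∀ p → Reach c′ d′ (f p) (f (d p))) →
            ∀ {p q} → Reach c d p q → Reach c′ d′ (f p) (f q)
reach-map f fc fd ε               = ε
reach-map f fc fd (inj₁ refl ◅ s) = fc _ ◅◅ reach-map f fc fd s
reach-map f fc fd (inj₂ refl ◅ s) = fd _ ◅◅ reach-map f fc fd s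

iterate : {X : Set} → (X → X) → ℕ → X → X
iterate f zero    x = x
iterate f (suc k) x = iterate f k (f x)

module _ {X : Set} (f : X → X) where

  iterate-suc : ∀ k x → iterate f (suc k) x ≡ f (iterate f k x)
  iterate-suc zero    x = refl
  iterate-suc (suc k) x = iterate-suc k (f x)

  iterate-+ : ∀ j k x → iterate f (j + k) x ≡ iterate f k (iterate f j x)
  iterate-+ zero    k x = refl
  iterate-+ (suc j) k x = iterate-+ j k (f x)

  module _ (f-injective : ∀ {x y} → f x ≡ f y → x ≡ y) where

    iterate-injective : ∀ k {x y} → iterate f k x ≡ iterate f k y → x ≡ y
    iterate-injective zero    e = e
    iterate-injective (suc k) e = f-injective (iterate-injective k e)

    -- By pigeonhole two iterates of `x` coincide, and injectivity cancels the smaller exponent.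
    iterate-recurs : ∀ {m} (enc : X → Fin m) → (∀ {x y} → enc x ≡ enc y → x ≡ y) →
                     ∀ x → ∃ λ k → iterate f (suc k) x ≡ x
    iterate-recurs enc enc-injective x
      with Fin.pigeonhole (ℕ.n<1+n _) (λ i → enc (iterate f (toℕ i) x))
    ... | i , j , i<j , e with ℕ.m≤n⇒∃[o]m+o≡n i<j
    ... | k , eq = k , sym (iterate-injective (toℕ i) (begin
      iterate f (toℕ i) x                     ≡⟨ enc-injective e ⟩
      iterate f (toℕ j) x                     ≡⟨ cong (λ l → iterate f l x) (sym eq) ⟩
      iterate f (suc (toℕ i) + k) x           ≡⟨ cong (λ l → iterate f l x) (cong suc (ℕ.+-comm (toℕ i) k)) ⟩
      iterate f (suc k + toℕ i) x             ≡⟨ iterate-+ (suc k) (toℕ i) x ⟩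
      iterate f (toℕ i) (iterate f (suc k) x) ∎))
      where open ≡-Reasoning

-- The graph with edges {p , c p} and {p , d p} consists of cycles and of paths;
-- the fixed points of d are the ends of the paths.
module Walk {X : Set} (_≟_ : DecidableEquality X)
            {m : ℕ} (enc : X → Fin m) (enc-injective : ∀ {x y} → enc x ≡ enc y → x ≡ y)
            {c d : X → X} (cc : SelfInverse c) (dd : SelfInverse d)
            (c-fixfree : ∀ p → c p ≢ p) where

  private
    r : X → X
    r = d ∘ c

    r-injective : ∀ {x y} → r x ≡ r y → x ≡ y
    r-injective {x} {y} e =
      trans (sym (cc x)) (trans (cong c (trans (sym (dd _)) (trans (cong d e) (dd _)))) (cc y))

  -- Fixed points of `d` are tested for only after a `c`-step, so a start fixed by `d` does not end
  -- the trail at once.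
  data Trail : X → X → Set where
    stop : ∀ {w} → d (c w) ≡ c w → Trail w (c w)
    go   : ∀ {w y} → d (c w) ≢ c w → Trail (d (c w)) y → Trail w y

  data On (z : X) : ∀ {w y} → Trail w y → Set where
    at   : ∀ {w y} {t : Trail w y} → z ≡ w → On z t
    at-c : ∀ {w y} {t : Trail w y} → z ≡ c w → On z t
    next : ∀ {w y n} {t : Trail (d (c w)) y} → On z t → On z (go n t)

  private
    trail-end-fixed : ∀ {w y} → Trail w y → d y ≡ y
    trail-end-fixed (stop e) = e
    trail-end-fixed (go _ t) = trail-end-fixed t

    trail⇒reach : ∀ {w y} → Trail w y → Reach c d w y
    trail⇒reach (stop e) = c-step
    trail⇒reach (go _ t) = inj₁ refl ◅ inj₂ refl ◅ trail⇒reach t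

    on-c : ∀ {w y z} (t : Trail w y) → On z t → On (c z) t
    on-c t (at refl)   = at-c refl
    on-c t (at-c refl) = at (cc _)
    on-c (go n t) (next o) = next (on-c t o)

    -- Every point but the start has its `d`-image inside: the last point is fixed, and the others
    -- are joined in pairs `c w`, `d (c w)`.
    on-d : ∀ {w y z} (t : Trail w y) → On z t → z ≡ w ⊎ On (d z) t
    on-d t        (at e)      = inj₁ e
    on-d (stop e) (at-c refl) = inj₂ (at-c e)
    on-d (go n t) (at-c refl) = inj₂ (next (at refl))
    on-d (go n t) (next o) with on-d t o
    ... | inj₁ refl = inj₂ (at-c (dd _))
    ... | inj₂ o′   = inj₂ (next o′)

    -- A fixed interior point is impossible: a fixed `c w` would have stopped the trail, and a fixed
    -- `d (c w)` would equal `c w`.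
    on-fixed : ∀ {w y z} (t : Trail w y) → On z t → d z ≡ z → z ≡ w ⊎ z ≡ y
    on-fixed t        (at e)      f = inj₁ e
    on-fixed (stop e) (at-c refl) f = inj₂ refl
    on-fixed (go n t) (at-c refl) f = contradiction f n
    on-fixed (go n t) (next o)    f with on-fixed t o f
    ... | inj₁ refl = contradiction (trans (sym f) (dd _)) n
    ... | inj₂ e    = inj₂ e

    trail-length : ∀ {w y} → Trail w y →
      ∃ λ k → y ≡ c (iterate r k w) × (∀ j → j < k → d (c (iterate r j w)) ≢ c (iterate r j w))
    trail-length (stop e) = 0 , refl , λ _ ()
    trail-length (go n t) with trail-length t
    ... | k , e , h = suc k , e , λ { zero _ → n ; (suc j) (s<s j<k) → h j j<k }

    -- A trail returning to its start would be a palindrome, with c or d fixing its centre.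
    no-return : ∀ k w → (∀ j → j < k → d (c (iterate r j w)) ≢ c (iterate r j w)) →
                c (iterate r k w) ≢ w
    no-return zero          w h e = c-fixfree w e
    no-return (suc zero)    w h e =
      h 0 z<s (trans (sym (cc _)) (cong c e))
    no-return (suc (suc k)) w h e = no-return k (r w) (λ j j<k → h (suc j) (s<s (ℕ.m<n⇒m<1+n j<k)))
      (trans (sym (dd _)) (cong d (trans (sym (iterate-suc r k (r w))) (trans (sym (cc _)) (cong c e)))))

    -- Here `k` only bounds the search: a fixed point of `d` occurs within `k` rounds, but the trail
    -- may stop at an earlier one.
    trail-from : ∀ k w → d (c (iterate r k w)) ≡ c (iterate r k w) → ∃ (Trail w)
    trail-from k w e with d (c w) ≟ c w
    ... | yes f = c w , stop f
    trail-from zero    w e | no n = contradiction e n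
    trail-from (suc k) w e | no n with trail-from k (r w) e
    ... | y , t = y , go n t

    trail : ∀ {x} → d x ≡ x → ∃ (Trail x)
    trail {x} dx with iterate-recurs r r-injective enc enc-injective x
    -- Recurrence gives `c (iterate r k x) ≡ d x ≡ x`, a fixed point of `d`, which guarantees that
    -- the search ends.
    ... | k , e = trail-from k x (trans back (trans (sym dx) (trans (cong d (sym back)) (dd _))))
      where
      back : d (c (iterate r k x)) ≡ x
      back = trans (sym (iterate-suc r k x)) e

  record Partner (x : X) : Set where
    field
      end       : X
      end-fixed : d end ≡ end
      end≢      : end ≢ x
      reachable : Reach c d x end
      only      : ∀ {z} → Reach c d x z → d z ≡ z → z ≡ x ⊎ z ≡ end

  abstract
    -- Only `d` at the start could leave the trail, and it fixes `x`; hence the trail is the whole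
    -- component of `x`. By `no-return` its other end differs from `x`.
    partner : ∀ {x} → d x ≡ x → Partner x
    partner {x} dx with trail dx
    ... | y , t with trail-length t
    ... | k , e , h = record
      { end       = y
      ; end-fixed = trail-end-fixed t
      ; end≢      = λ y≡x → no-return k x h (trans (sym e) y≡x)
      ; reachable = trail⇒reach t
      ; only      = λ s → on-fixed t (reach-closed (λ z → On z t) (λ _ → on-c t) closed s (at refl))
      }
      where
      closed : ∀ z → On z t → On (d z) t
      closed z o with on-d t o
      ... | inj₁ refl = at dx
      ... | inj₂ o′   = o′

-- Spanning quasi-trees

encode : Flag n → Fin (n * (2 * 2))
encode (e , i , s) = combine e (combine (Inverse.from Fin.2↔Bool i) (Inverse.from Fin.2↔Bool s))

encode-injective : {p q : Flag n} → encode p ≡ encode q → p ≡ q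
encode-injective {p = e , i , s} {f , j , t} eq
  with Fin.combine-injective e _ f _ eq
... | refl , eq′ with Fin.combine-injective (Inverse.from Fin.2↔Bool i) _ (Inverse.from Fin.2↔Bool j) _ eq′
... | eqᵢ , eqₛ = cong₂ (λ k l → e , k , l) (from-injective eqᵢ) (from-injective eqₛ)
  where
  from-injective : ∀ {x y} → Inverse.from Fin.2↔Bool x ≡ Inverse.from Fin.2↔Bool y → x ≡ y
  from-injective {x} {y} h = trans (sym (Inverse.strictlyInverseˡ Fin.2↔Bool x))
    (trans (cong (Inverse.to Fin.2↔Bool) h) (Inverse.strictlyInverseˡ Fin.2↔Bool y))

abstract
  reach? : (c d : Flag n → Flag n) → Decidable (Reach c d)
  reach? c d = Reachability.star? _≟ᶠ_ (λ p q → (q ≟ᶠ c p) ⊎-dec (q ≟ᶠ d p)) (allFlags _) ∈-allFlags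

-- What `follow` becomes when the edge of the flag is toggled in `φ`. The two commute, and together
-- they act transitively on the four flags of a ribbon.
other : Subset n → Flag n → Flag n
other φ p = if lookup φ (edge p) then acrossEnd p else alongSide p

module _ (φ : Subset n) where

  follow-edge : ∀ p → edge (follow φ p) ≡ edge p
  follow-edge (e , i , s) with lookup φ e
  ... | true  = refl
  ... | false = refl

  other-edge : ∀ p → edge (other φ p) ≡ edge p
  other-edge (e , i , s) with lookup φ e
  ... | true  = refl
  ... | false = refl

  follow-involutive : SelfInverse (follow φ)
  follow-involutive (e , i , s) with lookup φ e in eq
  ... | true  rewrite eq = cong (λ k → e , k , s) (Bool.not-involutive i)
  ... | false rewrite eq = cong (λ k → e , i , k) (Bool.not-involutive s)

  follow-fixfree : ∀ p → follow φ p ≢ p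
  follow-fixfree (e , i , s) eq with lookup φ e
  ... | true  = Bool.not-¬ refl (sym (cong (proj₁ ∘ proj₂) eq))
  ... | false = Bool.not-¬ refl (sym (cong (proj₂ ∘ proj₂) eq))

  follow-other : ∀ p → follow φ (other φ p) ≡ other φ (follow φ p)
  follow-other (e , i , s) with lookup φ e in eq
  ... | true  rewrite eq = refl
  ... | false rewrite eq = refl

  four-flags : ∀ p q → edge q ≡ edge p →
    (q ≡ p ⊎ q ≡ follow φ p) ⊎ (q ≡ other φ p ⊎ q ≡ follow φ (other φ p))
  four-flags (e , i , s) (.e , j , t) refl with lookup φ e in eq
  ... | true  rewrite eq = along (j Bool.≟ i) (t Bool.≟ s)
    where
    along : Dec (j ≡ i) → Dec (t ≡ s) → _
    along (yes refl) (yes refl) = inj₁ (inj₁ refl)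
    along (no j≢i)   (yes refl) = inj₁ (inj₂ (cong (λ k → e , k , t) (Bool.¬-not j≢i)))
    along (yes refl) (no t≢s)   = inj₂ (inj₁ (cong (λ k → e , j , k) (Bool.¬-not t≢s)))
    along (no j≢i)   (no t≢s)   = inj₂ (inj₂ (cong₂ (λ k l → e , k , l) (Bool.¬-not j≢i) (Bool.¬-not t≢s)))
  ... | false rewrite eq = across (j Bool.≟ i) (t Bool.≟ s)
    where
    across : Dec (j ≡ i) → Dec (t ≡ s) → _
    across (yes refl) (yes refl) = inj₁ (inj₁ refl)
    across (yes refl) (no t≢s)   = inj₁ (inj₂ (cong (λ k → e , j , k) (Bool.¬-not t≢s)))
    across (no j≢i)   (yes refl) = inj₂ (inj₁ (cong (λ k → e , k , t) (Bool.¬-not j≢i)))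
    across (no j≢i)   (no t≢s)   = inj₂ (inj₂ (cong₂ (λ k l → e , k , l) (Bool.¬-not j≢i) (Bool.¬-not t≢s)))

follow-cong : (φ ψ : Subset n) (p : Flag n) → lookup φ (edge p) ≡ lookup ψ (edge p) → follow φ p ≡ follow ψ p
follow-cong φ ψ p eq = cong (if_then alongSide p else acrossEnd p) eq

follow-other-cong : (φ ψ : Subset n) (p : Flag n) →
  lookup φ (edge p) ≡ not (lookup ψ (edge p)) → follow φ p ≡ other ψ p
follow-other-cong φ ψ p eq rewrite eq with lookup ψ (edge p)
... | true  = refl
... | false = refl

-- Opens the boundary at the ribbons in `K`: their flags become fixed points, hence the ends of the
-- paths described by `Walk`.
cut : (Fin n → Bool) → (Flag n → Flag n) → Flag n → Flag n
cut K d p = if K (edge p) then p else d p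

module _ (K : Fin n → Bool) (φ : Subset n) where

  cut-on : ∀ p → K (edge p) ≡ true → cut K (follow φ) p ≡ p
  cut-on p eq rewrite eq = refl

  cut-off : ∀ p → K (edge p) ≡ false → cut K (follow φ) p ≡ follow φ p
  cut-off p eq rewrite eq = refl

  cut-involutive : SelfInverse (cut K (follow φ))
  cut-involutive p with K (edge p) in eq
  ... | true  rewrite eq = refl
  ... | false rewrite trans (cong K (follow-edge φ p)) eq = follow-involutive φ p

  cut-fixed : ∀ p → cut K (follow φ) p ≡ p → K (edge p) ≡ true
  cut-fixed p eq with K (edge p)
  ... | true  = refl
  ... | false = contradiction eq (follow-fixfree φ p)

only : Fin n → Fin n → Bool
only e f = does (f Fin.≟ e)

only-self : (e : Fin n) → only e e ≡ true
only-self e = dec-true (e Fin.≟ e) refl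

only-true : {e f : Fin n} → only e f ≡ true → f ≡ e
only-true {e = e} {f} eq with f Fin.≟ e
... | yes f≡e = f≡e

-- Growing one boundary component until it contains all flags

module _ {c : Flag n → Flag n} (cc : SelfInverse c) (c-fixfree : ∀ p → c p ≢ p) where

  module FlagWalk (K : Fin n → Bool) (φ : Subset n) =
    Walk _≟ᶠ_ encode encode-injective {d = cut K (follow φ)} cc (cut-involutive K φ) c-fixfree

  cut⇒full : ∀ K φ {p q} → Reach c (cut K (follow φ)) p q → Reach c (follow φ) p q
  cut⇒full K φ = reach-map (λ p → p) (λ _ → c-step) step
    where
    step : ∀ p → Reach c (follow φ) p (cut K (follow φ) p)
    step p with K (edge p)
    ... | true  = ε
    ... | false = d-step

  -- Toggling an edge that touches two boundary components merges them.
  module _ {φ : Subset n} {x p : Flag n} (x⇝p : Reach c (follow φ) x p)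
           (apart : ¬ Reach c (follow φ) x (other φ p)) where

    private
      e : Fin n
      e = edge p

      φ′ : Subset n
      φ′ = φ [ e ]≔ not (lookup φ e)

      agree : ∀ q → edge q ≢ e → follow φ′ q ≡ follow φ q
      agree q q≢e = follow-cong φ′ φ q (lookup∘update′ q≢e φ _)

      toggled : follow φ′ p ≡ other φ p
      toggled = follow-other-cong φ′ φ p (lookup∘update e φ _)

      module W = FlagWalk (only e) φ
      module P = W.Partner (W.partner {p} (cut-on (only e) φ p (only-self e)))

      near : ∀ {q} → edge q ≡ e → Reach c (follow φ) x q → q ≡ p ⊎ q ≡ follow φ p
      near {q} q≡e x⇝q with four-flags φ p q q≡e
      ... | inj₁ h           = h
      ... | inj₂ (inj₁ refl) = contradiction x⇝q apart
      ... | inj₂ (inj₂ refl) =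
        contradiction (x⇝q ◅◅ inj₂ (sym (follow-involutive φ _)) ◅ ε) apart

      cut⇒toggled : ∀ {q q′} → Reach c (cut (only e) (follow φ)) q q′ → Reach c (follow φ′) q q′
      cut⇒toggled = reach-map (λ q → q) (λ _ → c-step) step
        where
        step : ∀ q → Reach c (follow φ′) q (cut (only e) (follow φ) q)
        step q with edge q Fin.≟ e
        ... | yes _  = ε
        ... | no q≢e = inj₂ (sym (agree q q≢e)) ◅ ε

      -- Cut at `e`, the path from `p` ends at another flag of `e`. Two of them lie in a different
      -- component, so it ends at `follow φ p`; as it avoids the ribbon `e`, it survives the toggle.
      p⇝′dp : Reach c (follow φ′) p (follow φ p)
      p⇝′dp with near (only-true (cut-fixed (only e) φ _ P.end-fixed)) (x⇝p ◅◅ cut⇒full (only e) φ P.reachable)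
      ... | inj₁ eq = contradiction eq P.end≢
      ... | inj₂ eq = subst (Reach c (follow φ′) p) eq (cut⇒toggled P.reachable)

      preserve : ∀ {q} → Reach c (follow φ) x q → Reach c (follow φ′) x q
      preserve x⇝q = proj₂ (reach-closed
        (λ q → Reach c (follow φ) x q × Reach c (follow φ′) x q)
        (λ q (h , h′) → h ◅◅ c-step , h′ ◅◅ c-step)
        (λ q (h , h′) → h ◅◅ d-step , h′ ◅◅ d-preserve q h)
        x⇝q (ε , ε))
        where
        d-preserve : ∀ q → Reach c (follow φ) x q → Reach c (follow φ′) q (follow φ q)
        d-preserve q h with edge q Fin.≟ e
        ... | no q≢e  = inj₂ (sym (agree q q≢e)) ◅ ε
        ... | yes q≡e with near q≡e h
        ... | inj₁ refl = p⇝′dp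
        ... | inj₂ refl = subst (Reach c (follow φ′) (follow φ p)) (sym (follow-involutive φ p))
                            (reach-sym cc (follow-involutive φ′) p⇝′dp)

    merge : ∃ λ φ′ → (∀ {q} → Reach c (follow φ) x q → Reach c (follow φ′) x q) ×
                     Reach c (follow φ′) x (other φ p)
    merge = φ′ , preserve , preserve x⇝p ◅◅ inj₂ (sym toggled) ◅ ε

  Extends : Flag n → Subset n → Subset n → Set
  Extends x φ φ′ = ∀ {q} → Reach c (follow φ) x q → Reach c (follow φ′) x q

  extend-other : ∀ {x p} φ → Reach c (follow φ) x p →
                 ∃ λ φ′ → Extends x φ φ′ × Reach c (follow φ′) x (other φ p)
  extend-other {x} {p} φ h with reach? c (follow φ) x (other φ p)
  ... | yes g = φ , (λ h′ → h′) , g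
  ... | no ¬g = merge {φ = φ} h ¬g

  extend-step : ∀ {x p q} φ → Reach c (follow φ) x p → GraphStep c p q →
                ∃ λ φ′ → Extends x φ φ′ × Reach c (follow φ′) x q
  extend-step φ h (inj₁ refl) = φ , (λ h′ → h′) , h ◅◅ c-step
  extend-step {x} {p} {q} φ h (inj₂ e) with four-flags φ p q (same-edge e)
    where
    same-edge : q ≡ acrossEnd p ⊎ q ≡ alongSide p → edge q ≡ edge p
    same-edge (inj₁ refl) = refl
    same-edge (inj₂ refl) = refl
  ... | inj₁ (inj₁ refl) = φ , (λ h′ → h′) , h
  ... | inj₁ (inj₂ refl) = φ , (λ h′ → h′) , h ◅◅ d-step
  ... | inj₂ (inj₁ refl) = extend-other φ h
  ... | inj₂ (inj₂ refl)
    rewrite follow-other φ p = extend-other φ (h ◅◅ d-step)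

  extend-path : ∀ {x p q} φ → Reach c (follow φ) x p → Star (GraphStep c) p q →
                ∃ λ φ′ → Extends x φ φ′ × Reach c (follow φ′) x q
  extend-path φ h ε       = φ , (λ h′ → h′) , h
  extend-path φ h (r ◅ s) with extend-step φ h r
  ... | φ₁ , ext₁ , h₁ with extend-path φ₁ h₁ s
  ... | φ₂ , ext₂ , h₂ = φ₂ , (λ h′ → ext₂ (ext₁ h′)) , h₂

  -- Flags are absorbed one at a time along a path in the graph, toggling an edge whenever the path
  -- leaves the component of `x`. By `Extends` nothing reached before is lost.
  extend-list : (∀ p q → Star (GraphStep c) p q) → ∀ x qs →
                ∃ λ φ → All (Reach c (follow φ) x) qs
  extend-list conn x []       = ∅ , []
  extend-list conn x (q ∷ qs) with extend-list conn x qs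
  ... | φ , all with extend-path φ ε (conn x q)
  ... | φ′ , ext , h = φ′ , h ∷ All.map ext all

quasi-tree : ∀ Γ → ∃ (ConnectedBoundary Γ)
-- The number of edges is split through `m`, because a base flag exists only if it is positive.
quasi-tree Γ = from (#edges Γ) refl
  where
  from : ∀ m → m ≡ #edges Γ → ∃ (ConnectedBoundary Γ)
  from zero    refl = ∅ , λ ()
  from (suc _) refl with extend-list (involutive Γ) (fixfree Γ) (connected Γ) (Fin.zero , false , false) (allFlags _)
  ... | φ , all = φ , λ p q →
    reach-sym (involutive Γ) (follow-involutive φ) (All.lookup all (∈-allFlags p)) ◅◅ All.lookup all (∈-allFlags q)

-- The binary representation of a ribbon graph

⨁ : List X → (X → Bool) → Bool
⨁ []       u = false
⨁ (x ∷ xs) u = u x xor ⨁ xs u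

⨁-cong : ∀ (xs : List X) {u v : X → Bool} → (∀ x → u x ≡ v x) → ⨁ xs u ≡ ⨁ xs v
⨁-cong []       e = refl
⨁-cong (x ∷ xs) e = cong₂ _xor_ (e x) (⨁-cong xs e)

⨁-false : ∀ (xs : List X) {u} → (∀ {x} → x ∈ˡ xs → u x ≡ false) → ⨁ xs u ≡ false
⨁-false []       e = refl
⨁-false (x ∷ xs) e = cong₂ _xor_ (e (here refl)) (⨁-false xs (e ∘ there))

⨁-xor : ∀ (xs : List X) u v → ⨁ xs (λ x → u x xor v x) ≡ ⨁ xs u xor ⨁ xs v
⨁-xor []       u v = refl
⨁-xor (x ∷ xs) u v = trans (cong ((u x xor v x) xor_) (⨁-xor xs u v))
  (solve 4 (λ a b c d → (a :+ b) :+ (c :+ d) := (a :+ c) :+ (b :+ d)) refl (u x) (v x) (⨁ xs u) (⨁ xs v))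
  where open xor-∧-Solver

⨁-++ : ∀ (xs ys : List X) u → ⨁ (xs ++ ys) u ≡ ⨁ xs u xor ⨁ ys u
⨁-++ []       ys u = refl
⨁-++ (x ∷ xs) ys u = trans (cong (u x xor_) (⨁-++ xs ys u)) (sym (Bool.xor-assoc (u x) _ _))

⨁-map : ∀ (f : X → Y) xs u → ⨁ (map f xs) u ≡ ⨁ xs (u ∘ f)
⨁-map f []       u = refl
⨁-map f (x ∷ xs) u = cong (u (f x) xor_) (⨁-map f xs u)

⨁-cartesianProduct : ∀ (xs : List X) (ys : List Y) u →
  ⨁ (cartesianProduct xs ys) u ≡ ⨁ xs (λ x → ⨁ ys (λ y → u (x , y)))
⨁-cartesianProduct []       ys u = refl
⨁-cartesianProduct (x ∷ xs) ys u =
  trans (⨁-++ (map (x ,_) ys) _ u) (cong₂ _xor_ (⨁-map (x ,_) ys u) (⨁-cartesianProduct xs ys u))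

⨁-tabulate : (f : Fin n → X) (u : X → Bool) → ⨁ (tabulate f) u ≡ sum₂ (u ∘ f)
⨁-tabulate {n = zero}  f u = refl
⨁-tabulate {n = suc n} f u = cong (u (f Fin.zero) xor_) (⨁-tabulate (f ∘ Fin.suc) u)

⨁-single : ∀ {xs : List X} {x u} → Unique xs → x ∈ˡ xs → (∀ y → y ≢ x → u y ≡ false) → ⨁ xs u ≡ u x
⨁-single {u = u} (x∉xs ∷ _) (here refl) off =
  trans (cong (u _ xor_) (⨁-false _ λ y∈xs → off _ (≢-sym (All.lookup x∉xs y∈xs)))) (Bool.xor-identityʳ _)
⨁-single (y∉xs ∷ unique) (there x∈xs) off =
  cong₂ _xor_ (off _ (All.lookup y∉xs x∈xs)) (⨁-single unique x∈xs off)

-- Induction on the list: the row and the column of the first element agree by symmetry and cancel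
-- in characteristic 2.
⨁-alternating : ∀ (xs : List X) (k : X → X → Bool) → (∀ x y → k x y ≡ k y x) → (∀ x → k x x ≡ false) →
                ⨁ xs (λ x → ⨁ xs (k x)) ≡ false
⨁-alternating []       k sym-k diag = refl
⨁-alternating (x ∷ xs) k sym-k diag = begin
  (k x x xor ⨁ xs (k x)) xor ⨁ xs (λ y → k y x xor ⨁ xs (k y))
    ≡⟨ cong₂ (λ a b → (a xor ⨁ xs (k x)) xor b) (diag x) (⨁-xor xs (λ y → k y x) _) ⟩
  ⨁ xs (k x) xor (⨁ xs (λ y → k y x) xor ⨁ xs (λ y → ⨁ xs (k y)))
    ≡⟨ cong₂ (λ a b → ⨁ xs (k x) xor (a xor b)) (⨁-cong xs λ y → sym-k y x) (⨁-alternating xs k sym-k diag) ⟩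
  ⨁ xs (k x) xor (⨁ xs (k x) xor false)
    ≡⟨ cong (⨁ xs (k x) xor_) (Bool.xor-identityʳ _) ⟩
  ⨁ xs (k x) xor ⨁ xs (k x)
    ≡⟨ Bool.xor-same (⨁ xs (k x)) ⟩
  false ∎
  where open ≡-Reasoning

-- A sum over the orbits of c, each of which contributes twice.
⨁-flags-even : ∀ {c : Flag n → Flag n} → SelfInverse c → (∀ p → c p ≢ p) →
               ∀ u → (∀ p → u (c p) ≡ u p) → ⨁ (allFlags n) u ≡ false
⨁-flags-even {n = n} {c} cc c-fixfree u u-c = trans
  (⨁-cong (allFlags n) λ p → sym (row p))
  (⨁-alternating (allFlags n) k sym-k diag)
  where
  -- The permutation matrix of `c` weighted by `u`: its row sums are `u`, it is symmetric because
  -- `u` is invariant, and its diagonal vanishes because `c` has no fixed points.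
  k : Flag n → Flag n → Bool
  k p q = does (q ≟ᶠ c p) ∧ u p

  unique : Unique (allFlags n)
  unique = cartesianProduct⁺ (allFin⁺ n) (cartesianProduct⁺ bools bools)
    where
    bools : Unique allBool
    bools = ((λ ()) All.∷ All.[]) ∷ All.[] ∷ []

  row : ∀ p → ⨁ (allFlags n) (k p) ≡ u p
  row p = trans
    (⨁-single {u = k p} unique (∈-allFlags (c p)) λ q q≢cp → cong (_∧ u p) (dec-false (q ≟ᶠ c p) q≢cp))
    (cong (_∧ u p) (dec-true (c p ≟ᶠ c p) refl))

  sym-k : ∀ p q → k p q ≡ k q p
  sym-k p q with q ≟ᶠ c p
  ... | yes refl rewrite dec-true (p ≟ᶠ c (c p)) (sym (cc p)) = sym (u-c p)
  ... | no q≢cp  rewrite dec-false (p ≟ᶠ c q) (λ p≡cq → q≢cp (trans (sym (cc q)) (cong c (sym p≡cq)))) = refl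

  diag : ∀ p → k p p ≡ false
  diag p rewrite dec-false (p ≟ᶠ c p) (≢-sym (c-fixfree p)) = refl

reached : (c d : Flag n → Flag n) → Flag n → Flag n → Bool
reached c d p q = does (reach? c d p q)

module _ (c d : Flag n → Flag n) (cc : SelfInverse c) (dd : SelfInverse d) where

  reached-c : ∀ p q → reached c d p (c q) ≡ reached c d p q
  reached-c p q = does-⇔ (mk⇔ (λ h → h ◅◅ inj₁ (sym (cc q)) ◅ ε) (_◅◅ c-step)) (reach? c d p (c q)) (reach? c d p q)

  reached-d : ∀ p q → reached c d p (d q) ≡ reached c d p q
  reached-d p q = does-⇔ (mk⇔ (λ h → h ◅◅ inj₂ (sym (dd q)) ◅ ε) (_◅◅ d-step)) (reach? c d p (d q)) (reach? c d p q)

module _ (φ : Subset n) where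

  other≢ : ∀ p → other φ p ≢ p
  other≢ (e , i , s) eq with lookup φ e
  ... | true  = Bool.not-¬ refl (sym (cong (proj₂ ∘ proj₂) eq))
  ... | false = Bool.not-¬ refl (sym (cong (proj₁ ∘ proj₂) eq))

  other≢follow : ∀ p → other φ p ≢ follow φ p
  other≢follow (e , i , s) eq with lookup φ e
  ... | true  = Bool.not-¬ refl (sym (cong (proj₂ ∘ proj₂) eq))
  ... | false = Bool.not-¬ refl (sym (cong (proj₁ ∘ proj₂) eq))

  other-involutive : SelfInverse (other φ)
  other-involutive (e , i , s) with lookup φ e in eq
  ... | true  rewrite eq = cong (λ k → e , i , k) (Bool.not-involutive s)
  ... | false rewrite eq = cong (λ k → e , k , s) (Bool.not-involutive i)

  edge-induction : (P : Flag n → Set) → (∀ r → P r → P (follow φ r)) → (∀ r → P r → P (other φ r)) →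
                   ∀ p → P p → ∀ q → edge q ≡ edge p → P q
  edge-induction P Pd Po p Pp q q≡p with four-flags φ p q q≡p
  ... | inj₁ (inj₁ refl) = Pp
  ... | inj₁ (inj₂ refl) = Pd p Pp
  ... | inj₂ (inj₁ refl) = Po p Pp
  ... | inj₂ (inj₂ refl) = Pd _ (Po p Pp)

subset-ext : {x y : Subset n} → (∀ e → lookup x e ≡ lookup y e) → x ≡ y
subset-ext {x = x} {y} e = trans (sym (tabulate∘lookup x)) (trans (tabulate-cong e) (tabulate∘lookup y))

xor≡false : ∀ {x y} → x xor y ≡ false → x ≡ y
xor≡false {false} {false} _ = refl
xor≡false {true}  {true}  _ = refl

-- Potentials and the matrix of a quasi-tree

module QuasiTree {c : Flag n → Flag n} (cc : SelfInverse c) (c-fixfree : ∀ p → c p ≢ p)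
                 (A : Subset n) (conn : ∀ p q → Reach c (follow A) p q) where

  d o : Flag n → Flag n
  d = follow A
  o = other A

  base : Fin n → Flag n
  base e = e , false , false

  -- By connectedness, the boundary of A is a single cycle; cutting it at the edge f
  -- leaves two paths, of which this one contains base f.
  potential : Fin n → Flag n → Bool
  potential f = reached c (cut (only f) d) (base f)

  potential-c : ∀ f p → potential f (c p) ≡ potential f p
  potential-c f = reached-c c (cut (only f) d) cc (cut-involutive (only f) A) (base f)

  private
    module Cut (f : Fin n) where

      x : Flag n
      x = base f

      d₀ : Flag n → Flag n
      d₀ = cut (only f) d

      module W = FlagWalk cc c-fixfree (only f) A

      open W.Partner (W.partner {x} (cut-on (only f) A x (only-self f)))
        renaming (end to y; only to only-ends) public

      d₀-fixed : ∀ p → edge p ≡ f → d₀ p ≡ p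
      d₀-fixed p refl = cut-on (only f) A p (only-self f)

      -- Otherwise restoring `d` would close the path from `x` into a cycle missing `o x`, whereas
      -- the boundary of `A` is a single cycle.
      y≢dx : y ≢ d x
      y≢dx y≡dx with only-ends o-reached (d₀-fixed (o x) (other-edge A x))
        where
        closed-d : ∀ p → Reach c d₀ x p → Reach c d₀ x (d p)
        closed-d p h with edge p Fin.≟ f
        ... | no p≢f = h ◅◅ inj₂ (sym (cut-off (only f) A p (dec-false (edge p Fin.≟ f) p≢f))) ◅ ε
        ... | yes p≡f with only-ends h (d₀-fixed p p≡f)
        ... | inj₁ refl = subst (Reach c d₀ x) y≡dx reachable
        ... | inj₂ refl = subst (Reach c d₀ x) (sym (trans (cong d y≡dx) (follow-involutive A x))) ε

        o-reached : Reach c d₀ x (o x)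
        o-reached = reach-closed (Reach c d₀ x) (λ _ → _◅◅ c-step) closed-d (conn x (o x)) ε
      ... | inj₁ ox≡x = other≢ A x ox≡x
      ... | inj₂ ox≡y = other≢follow A x (trans ox≡y y≡dx)

      far-end : y ≡ o x ⊎ y ≡ d (o x)
      far-end with four-flags A x y (only-true (cut-fixed (only f) A y end-fixed))
      ... | inj₁ (inj₁ y≡x)  = contradiction y≡x end≢
      ... | inj₁ (inj₂ y≡dx) = contradiction y≡dx y≢dx
      ... | inj₂ h           = h

      one-side : ∀ p → edge p ≡ f → Reach c d₀ x p ⊎ Reach c d₀ x (d p)
      one-side p p≡f with four-flags A x p p≡f | far-end
      ... | inj₁ (inj₁ refl) | _         = inj₁ ε
      ... | inj₁ (inj₂ refl) | _         = inj₂ (subst (Reach c d₀ x) (sym (follow-involutive A x)) ε)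
      ... | inj₂ (inj₁ refl) | inj₁ y≡ox = inj₁ (subst (Reach c d₀ x) y≡ox reachable)
      ... | inj₂ (inj₁ refl) | inj₂ y≡   = inj₂ (subst (Reach c d₀ x) y≡ reachable)
      ... | inj₂ (inj₂ refl) | inj₁ y≡ox =
        inj₂ (subst (Reach c d₀ x) (trans y≡ox (sym (follow-involutive A (o x)))) reachable)
      ... | inj₂ (inj₂ refl) | inj₂ y≡   = inj₁ (subst (Reach c d₀ x) y≡ reachable)

      not-both : ∀ p → edge p ≡ f → Reach c d₀ x p → ¬ Reach c d₀ x (d p)
      not-both p p≡f h h′
        with only-ends h (d₀-fixed p p≡f) | only-ends h′ (d₀-fixed (d p) (trans (follow-edge A p) p≡f))
      ... | inj₁ p≡x | inj₁ dp≡x = follow-fixfree A p (trans dp≡x (sym p≡x))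
      ... | inj₁ p≡x | inj₂ dp≡y = y≢dx (trans (sym dp≡y) (cong d p≡x))
      ... | inj₂ p≡y | inj₁ dp≡x = y≢dx (trans (sym p≡y) (trans (sym (follow-involutive A p)) (cong d dp≡x)))
      ... | inj₂ p≡y | inj₂ dp≡y = follow-fixfree A p (trans dp≡y (sym p≡y))

  -- Away from `f` the step stays on its path. At `f` it changes sides: the path of `base f`
  -- contains at least one of `p` and `d p` by `one-side`, and at most one by `not-both`.
  potential-d : ∀ f p → potential f (d p) ≡ potential f p xor only f (edge p)
  potential-d f p with edge p Fin.≟ f
  ... | no p≢f = trans
    (trans (cong (potential f) (sym (cut-off (only f) A p (dec-false (edge p Fin.≟ f) p≢f))))
           (reached-d c (cut (only f) d) cc (cut-involutive (only f) A) (base f) p))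
    (sym (Bool.xor-identityʳ _))
  ... | yes p≡f with Cut.one-side f p p≡f
  ... | inj₁ h = trans (dec-false (reach? c _ (base f) (d p)) (Cut.not-both f p p≡f h))
    (cong (_xor true) (sym (dec-true (reach? c _ (base f) p) h)))
  ... | inj₂ h = trans (dec-true (reach? c _ (base f) (d p)) h)
    (cong (_xor true) (sym (dec-false (reach? c _ (base f) p) λ h′ → Cut.not-both f p p≡f h′ h)))

  -- For `A ≡ ∅`, a graph with one vertex, this is the interlacement matrix of the loops, with
  -- twisted loops marked on the diagonal.
  matrix : Matrix₂ n
  matrix u v = potential v (base u) xor potential v (o (base u))

  private
    edge-block : ∀ (u : Flag n → Bool) e →
      ⨁ (cartesianProduct allBool allBool) (λ is → u (e , is)) ≡
      (u (base e) xor u (d (base e))) xor (u (o (base e)) xor u (d (o (base e))))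
    edge-block u e with lookup A e in eq
    ... | true  rewrite eq = solve 4 (λ p q r s → p :+ (q :+ (r :+ (s :+ con false))) := (p :+ r) :+ (q :+ s))
      refl (u (e , false , false)) (u (e , false , true)) (u (e , true , false)) (u (e , true , true))
      where open xor-∧-Solver
    ... | false rewrite eq = solve 4 (λ p q r s → p :+ (q :+ (r :+ (s :+ con false))) := (p :+ q) :+ (r :+ s))
      refl (u (e , false , false)) (u (e , false , true)) (u (e , true , false)) (u (e , true , true))
      where open xor-∧-Solver

    -- By `potential-d` each of the two pairs joined by `d` contributes `only e g ∧ only f g`; these
    -- cancel, and the mixed terms remain.
    product-block : ∀ e f g →
      ⨁ (cartesianProduct allBool allBool) (λ is → potential e (g , is) ∧ potential f (g , is)) ≡
      (only f g ∧ matrix g e) xor (only e g ∧ matrix g f)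
    product-block e f g
      rewrite edge-block (λ p → potential e p ∧ potential f p) g
            | potential-d e (base g) | potential-d f (base g)
            | potential-d e (o (base g)) | potential-d f (o (base g))
            | other-edge A (base g)
      = solve 6 (λ a b a′ b′ x y →
          ((a :* b) :+ ((a :+ x) :* (b :+ y))) :+ ((a′ :* b′) :+ ((a′ :+ x) :* (b′ :+ y)))
          := (y :* (a :+ a′)) :+ (x :* (b :+ b′)))
        refl (potential e (base g)) (potential f (base g)) (potential e (o (base g))) (potential f (o (base g)))
             (only e g) (only f g)
      where open xor-∧-Solver

    pick : ∀ e (u : Fin n → Bool) → ⨁ (allFin n) (λ g → only e g ∧ u g) ≡ u e
    pick e u = trans
      (⨁-single (allFin⁺ n) (∈-allFin e) λ g g≢e → cong (_∧ u g) (dec-false (g Fin.≟ e) g≢e))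
      (cong (_∧ u e) (only-self e))

  -- The sum of potential e ∧ potential f over all flags vanishes, as it is invariant
  -- under c; grouping it by edges, only the blocks of e and f survive.
  matrix-symmetric : ∀ e f → matrix e f ≡ matrix f e
  matrix-symmetric e f = sym (xor≡false (begin
    matrix f e xor matrix e f
      ≡⟨ cong₂ _xor_ (sym (pick f λ g → matrix g e)) (sym (pick e λ g → matrix g f)) ⟩
    ⨁ (allFin n) (λ g → only f g ∧ matrix g e) xor ⨁ (allFin n) (λ g → only e g ∧ matrix g f)
      ≡⟨ sym (⨁-xor (allFin n) _ _) ⟩
    ⨁ (allFin n) (λ g → (only f g ∧ matrix g e) xor (only e g ∧ matrix g f))
      ≡⟨ ⨁-cong (allFin n) (λ g → sym (product-block e f g)) ⟩
    ⨁ (allFin n) (λ g → ⨁ (cartesianProduct allBool allBool) λ is → potential e (g , is) ∧ potential f (g , is))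
      ≡⟨ sym (⨁-cartesianProduct (allFin n) _ _) ⟩
    ⨁ (allFlags n) (λ p → potential e p ∧ potential f p)
      ≡⟨ ⨁-flags-even cc c-fixfree _ (λ p → cong₂ _∧_ (potential-c e p) (potential-c f p)) ⟩
    false ∎))
    where
    open ≡-Reasoning

  framedGraph : FramedGraph
  framedGraph = record
    { order       = n
    ; adjacent    = λ u v → if does (u Fin.≟ v) then false else matrix u v
    ; symmetric   = symmetric′
    ; irreflexive = λ v → cong (if_then false else matrix v v) (dec-true (v Fin.≟ v) refl)
    ; framing     = λ v → matrix v v
    }
    where
    symmetric′ : ∀ u v → (if does (u Fin.≟ v) then false else matrix u v) ≡
                         (if does (v Fin.≟ u) then false else matrix v u)
    symmetric′ u v with u Fin.≟ v
    ... | yes u≡v rewrite dec-true (v Fin.≟ u) (sym u≡v) = refl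
    ... | no u≢v  rewrite dec-false (v Fin.≟ u) (≢-sym u≢v) = matrix-symmetric u v

  adjacencyMatrix≡matrix : ∀ u v → adjacencyMatrix framedGraph u v ≡ matrix u v
  adjacencyMatrix≡matrix u v with u Fin.≟ v
  ... | yes refl = refl
  ... | no _     = refl

  -- A primitive of `x`: the function invariant under `c` whose jump across each edge `e` is the
  -- entry of `x` at `e`.
  combination : Subset n → Flag n → Bool
  combination x p = ⨁ (allFin n) (λ f → potential f p ∧ lookup x f)

  combination-c : ∀ x p → combination x (c p) ≡ combination x p
  combination-c x p = ⨁-cong (allFin n) λ f → cong (_∧ lookup x f) (potential-c f p)

  combination-d : ∀ x p → combination x (d p) ≡ combination x p xor lookup x (edge p)
  combination-d x p = begin
    ⨁ (allFin n) (λ f → potential f (d p) ∧ lookup x f)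
      ≡⟨ ⨁-cong (allFin n) (λ f → trans (cong (_∧ lookup x f) (potential-d f p))
           (Bool.∧-distribʳ-xor (lookup x f) (potential f p) (only f (edge p)))) ⟩
    ⨁ (allFin n) (λ f → (potential f p ∧ lookup x f) xor (only f (edge p) ∧ lookup x f))
      ≡⟨ ⨁-xor (allFin n) _ _ ⟩
    combination x p xor ⨁ (allFin n) (λ f → only f (edge p) ∧ lookup x f)
      ≡⟨ cong (combination x p xor_) (⨁-single (allFin⁺ n) (∈-allFin (edge p)) λ f f≢e →
           cong (_∧ lookup x f) (dec-false (edge p Fin.≟ f) (≢-sym f≢e))) ⟩
    combination x p xor (only (edge p) (edge p) ∧ lookup x (edge p))
      ≡⟨ cong (λ b → combination x p xor (b ∧ lookup x (edge p))) (only-self (edge p)) ⟩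
    combination x p xor lookup x (edge p) ∎
    where open ≡-Reasoning

  -- Turns the kernel equation in row `u` into invariance of `combination x` under `o` at the base
  -- flag of `u`.
  combination-o : ∀ x u → sum₂ (λ v → adjacencyMatrix framedGraph u v ∧ lookup x v) ≡
                          combination x (base u) xor combination x (o (base u))
  combination-o x u = begin
    sum₂ (λ v → adjacencyMatrix framedGraph u v ∧ lookup x v)
      ≡⟨ sym (⨁-tabulate (λ v → v) λ v → adjacencyMatrix framedGraph u v ∧ lookup x v) ⟩
    ⨁ (allFin n) (λ v → adjacencyMatrix framedGraph u v ∧ lookup x v)
      ≡⟨ ⨁-cong (allFin n) (λ v → trans (cong (_∧ lookup x v) (adjacencyMatrix≡matrix u v))
           (Bool.∧-distribʳ-xor (lookup x v) (potential v (base u)) (potential v (o (base u))))) ⟩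
    ⨁ (allFin n) (λ v → (potential v (base u) ∧ lookup x v) xor (potential v (o (base u)) ∧ lookup x v))
      ≡⟨ ⨁-xor (allFin n) _ _ ⟩
    combination x (base u) xor combination x (o (base u)) ∎
    where open ≡-Reasoning

-- Connected boundary and nondegeneracy

invariant-constant : {X : Set} {c d : X → X} (h : X → Bool) → (∀ p → h (c p) ≡ h p) → (∀ p → h (d p) ≡ h p) →
                     ∀ {p q} → Reach c d p q → h q ≡ h p
invariant-constant h hc hd {p} s =
  reach-closed (λ q → h q ≡ h p) (λ q e → trans (hc q) e) (λ q e → trans (hd q) e) s refl

≡⇒xor≡false : ∀ {x y} → x ≡ y → x xor y ≡ false
≡⇒xor≡false {x} refl = Bool.xor-same x

module _ {c : Flag n → Flag n} (cc : SelfInverse c) (c-fixfree : ∀ p → c p ≢ p)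
         (A : Subset n) (conn : ∀ p q → Reach c (follow A) p q) where

  open QuasiTree cc c-fixfree A conn

  module _ (φ : Subset n) where

    private
      S : Subset n
      S = φ △ A

      S-lookup : ∀ e → lookup S e ≡ lookup φ e xor lookup A e
      S-lookup e = lookup-zipWith _xor_ e φ A

      follow-outside : ∀ p → lookup S (edge p) ≡ false → follow φ p ≡ d p
      follow-outside p e = follow-cong φ A p (xor≡false (trans (sym (S-lookup _)) e))

      follow-inside : ∀ p → lookup S (edge p) ≡ true → follow φ p ≡ o p
      follow-inside p e = follow-other-cong φ A p (xor≡true (trans (sym (S-lookup _)) e))
        where
        xor≡true : ∀ {x y} → x xor y ≡ true → x ≡ not y
        xor≡true {false} {true}  _ = refl
        xor≡true {true}  {false} _ = refl

    -- A kernel vector `x` makes its primitive invariant under `follow φ`: under `o` on `S` by the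
    -- kernel equations, under `d` elsewhere because `x` vanishes there. The primitive is then
    -- constant, so all its jumps are zero.
    connected⇒nondegenerate : (∀ p q → Reach c (follow φ) p q) → Nondegenerate (adjacencyMatrix framedGraph) S
    connected⇒nondegenerate conn′ x x⊆S Mx = subset-ext λ e → trans
      (xor-cancelˡ (h (base e)) (trans (sym (combination-d x (base e))) (constant (base e) (d (base e)))))
      (sym (lookup-replicate e false))
      where
      xor-cancelˡ : ∀ a {b} → a xor b ≡ a → b ≡ false
      xor-cancelˡ false          e = e
      xor-cancelˡ true  {false} _ = refl

      h : Flag n → Bool
      h = combination x

      h-o : ∀ p → lookup S (edge p) ≡ true → h (o p) ≡ h p
      -- The kernel equation settles the base flag. The equality spreads over the ribbon, because
      -- `d` changes `h` by the same jump at `r` and at `o r`.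
      h-o p e∈S = edge-induction A (λ r → h (o r) ≡ h r)
        (λ r hr → trans (cong h (sym (follow-other A r))) (trans (combination-d x (o r))
          (trans (cong₂ (λ a f → a xor lookup x f) hr (other-edge A r)) (sym (combination-d x r)))))
        (λ r hr → trans (cong h (other-involutive A r)) (sym hr))
        (base (edge p))
        (sym (xor≡false (trans (sym (combination-o x (edge p))) (Mx (edge p) (lookup⇒[]= (edge p) S e∈S)))))
        p refl

      h-follow : ∀ p → h (follow φ p) ≡ h p
      h-follow p with lookup S (edge p) in eq
      ... | true  = trans (cong h (follow-inside p eq)) (h-o p eq)
      ... | false = trans (cong h (follow-outside p eq)) (trans (combination-d x p)
        (trans (cong (h p xor_) (x-outside (edge p) eq)) (Bool.xor-identityʳ _)))
        where
        x-outside : ∀ e → lookup S e ≡ false → lookup x e ≡ false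
        x-outside e e∉S with lookup x e in e∈x
        ... | false = refl
        ... | true with trans (sym e∉S) ([]=⇒lookup (x⊆S (lookup⇒[]= e x e∈x)))
        ... | ()

      constant : ∀ p q → h q ≡ h p
      constant p q = invariant-constant h (combination-c x) h-follow (conn′ p q)

    -- The jumps of the indicator `h` of one component form a kernel vector. Nondegeneracy makes
    -- them vanish, so `h` is invariant under `d` and constant on the single cycle of `A`.
    nondegenerate⇒connected : Nondegenerate (adjacencyMatrix framedGraph) S → ∀ p q → Reach c (follow φ) p q
    nondegenerate⇒connected nondeg p q = reached⇒reach (trans
      (invariant-constant h h-c h-d (conn p q)) (dec-true (reach? c (follow φ) p p) ε))
      where
      h : Flag n → Bool
      h = reached c (follow φ) p

      reached⇒reach : h q ≡ true → Reach c (follow φ) p q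
      reached⇒reach e with reach? c (follow φ) p q
      ... | yes r = r

      h-c : ∀ r → h (c r) ≡ h r
      h-c = reached-c c (follow φ) cc (follow-involutive φ) p

      h-follow : ∀ r → h (follow φ r) ≡ h r
      h-follow = reached-d c (follow φ) cc (follow-involutive φ) p

      h-o : ∀ r → lookup S (edge r) ≡ true → h (o r) ≡ h r
      h-o r e = trans (cong h (sym (follow-inside r e))) (h-follow r)

      D : Flag n → Bool
      D r = h (d r) xor h r

      D-outside : ∀ r → lookup S (edge r) ≡ false → D r ≡ false
      D-outside r e = ≡⇒xor≡false (trans (cong h (sym (follow-outside r e))) (h-follow r))

      D-o : ∀ r → D (o r) ≡ D r
      D-o r with lookup S (edge r) in eq
      ... | false = trans (D-outside (o r) (trans (cong (lookup S) (other-edge A r)) eq)) (sym (D-outside r eq))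
      ... | true  = cong₂ _xor_
        (trans (cong h (follow-other A r)) (h-o (d r) (trans (cong (lookup S) (follow-edge A r)) eq)))
        (h-o r eq)

      D-d : ∀ r → D (d r) ≡ D r
      D-d r = trans (cong (λ t → h t xor h (d r)) (follow-involutive A r)) (Bool.xor-comm (h r) (h (d r)))

      x : Subset n
      x = Vec.tabulate (D ∘ base)

      D-lookup : ∀ r → D r ≡ lookup x (edge r)
      D-lookup r = trans
        (edge-induction A (λ t → D t ≡ D (base (edge r)))
          (λ t → trans (D-d t)) (λ t → trans (D-o t)) (base (edge r)) refl r refl)
        (sym (lookup∘tabulate (D ∘ base) (edge r)))

      -- The functions `combination x` and `h` have the same jumps, so their sum is constant along
      -- the cycle of `A`. Thus `x` inherits its kernel equations from the invariance of `h` under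
      -- `o` at the edges of `S`.
      k : Flag n → Bool
      k r = combination x r xor h r

      k-c : ∀ r → k (c r) ≡ k r
      k-c r = cong₂ _xor_ (combination-c x r) (h-c r)

      k-d : ∀ r → k (d r) ≡ k r
      k-d r = begin
        combination x (d r) xor h (d r)
          ≡⟨ cong (_xor h (d r)) (trans (combination-d x r) (cong (combination x r xor_) (sym (D-lookup r)))) ⟩
        (combination x r xor (h (d r) xor h r)) xor h (d r)
          ≡⟨ solve 3 (λ a b b′ → (a :+ (b′ :+ b)) :+ b′ := a :+ b) refl (combination x r) (h r) (h (d r)) ⟩
        combination x r xor h r ∎
        where
        open ≡-Reasoning
        open xor-∧-Solver

      x-kernel : ∀ u → u ∈ S → sum₂ (λ v → adjacencyMatrix framedGraph u v ∧ lookup x v) ≡ false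
      x-kernel u u∈S = begin
        sum₂ (λ v → adjacencyMatrix framedGraph u v ∧ lookup x v)
          ≡⟨ combination-o x u ⟩
        combination x (base u) xor combination x (o (base u))
          ≡⟨ solve 4 (λ a a′ b b′ → a :+ a′ := ((a :+ b) :+ (a′ :+ b′)) :+ (b′ :+ b)) refl
               (combination x (base u)) (combination x (o (base u))) (h (base u)) (h (o (base u))) ⟩
        (k (base u) xor k (o (base u))) xor (h (o (base u)) xor h (base u))
          ≡⟨ cong₂ _xor_ (≡⇒xor≡false (invariant-constant k k-c k-d (conn (o (base u)) (base u))))
                         (≡⇒xor≡false (h-o (base u) ([]=⇒lookup u∈S))) ⟩
        false ∎
        where
        open ≡-Reasoning
        open xor-∧-Solver

      x⊆S : x ⊆ S
      x⊆S {e} e∈x with lookup S e in eq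
      ... | true  = lookup⇒[]= e S eq
      ... | false with trans (sym (D-outside (base e) eq)) (trans (D-lookup (base e)) ([]=⇒lookup e∈x))
      ... | ()

      h-d : ∀ r → h (d r) ≡ h r
      h-d r = xor≡false (begin
        D r               ≡⟨ D-lookup r ⟩
        lookup x (edge r) ≡⟨ cong (λ y → lookup y (edge r)) (nondeg x x⊆S x-kernel) ⟩
        lookup ∅ (edge r) ≡⟨ lookup-replicate (edge r) false ⟩
        false             ∎)
        where open ≡-Reasoning

-- Binarity of the delta-matroid

≗⇒iso : (F G : Subset n → Bool) → (∀ φ → F φ ≡ G φ) →
        Σ (Permutation n n) λ σ → ∀ φ → G φ ≡ F (Vec.tabulate λ e → lookup φ (σ ⟨$⟩ʳ e))
≗⇒iso F G F≗G = Permutation.id , λ φ → trans (sym (F≗G φ)) (cong F (sym (tabulate∘lookup φ)))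

-- deltaMatroid with an opaque feasibility predicate, which keeps the decision
-- procedure folded during type checking.
opaque
  hasConnectedBoundary : (Γ : EmbeddedGraph) → Subset (#edges Γ) → Bool
  hasConnectedBoundary Γ φ = does (connectedBoundary? Γ φ)

ribbonSystem : EmbeddedGraph → SetSystem
ribbonSystem Γ = record { size = #edges Γ ; feasible = hasConnectedBoundary Γ }

opaque
  unfolding hasConnectedBoundary

  ribbonSystem≡deltaMatroid : ∀ Γ → ribbonSystem Γ ≡ deltaMatroid Γ
  ribbonSystem≡deltaMatroid Γ = refl

  hasConnectedBoundary-true : ∀ Γ {φ} → ConnectedBoundary Γ φ → hasConnectedBoundary Γ φ ≡ true
  hasConnectedBoundary-true Γ {φ} conn = dec-true (connectedBoundary? Γ φ) conn

module _ (Γ : EmbeddedGraph) (A : Subset (#edges Γ)) (conn : ConnectedBoundary Γ A) where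

  open QuasiTree (involutive Γ) (fixfree Γ) A conn using (framedGraph)

  opaque
    unfolding hasConnectedBoundary

    connectedBoundary≡nondegenerate : ∀ φ →
      hasConnectedBoundary Γ φ ≡ does (nondegenerate? (adjacencyMatrix framedGraph) (φ △ A))
    connectedBoundary≡nondegenerate φ = does-⇔
      (mk⇔ (connected⇒nondegenerate {c = corner Γ} (involutive Γ) (fixfree Γ) A conn φ)
           (nondegenerate⇒connected {c = corner Γ} (involutive Γ) (fixfree Γ) A conn φ))
      (connectedBoundary? Γ φ) (nondegenerate? (adjacencyMatrix framedGraph) (φ △ A))

  quasi-tree⇒binary : IsBinary (ribbonSystem Γ)
  quasi-tree⇒binary = (A , hasConnectedBoundary-true Γ conn) , framedGraph , A ,
    ≗⇒iso (hasConnectedBoundary Γ) (feasible (twist (nondegeneracy framedGraph) A)) connectedBoundary≡nondegenerate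

abstract
  ribbonSystem-binary : ∀ Γ → IsBinary (ribbonSystem Γ)
  ribbonSystem-binary Γ = quasi-tree⇒binary Γ (proj₁ (quasi-tree Γ)) (proj₂ (quasi-tree Γ))

-- Sliding in a graph with two edges

Port : Set
Port = Flag 2

ends : (endᵃ endᵇ : Bool) → Subset 2
ends α β = α ∷ β ∷ []

pattern 𝕒 = zero
pattern 𝕓 = suc zero

opaque
  -- The regluing of a handle slide, in labels for which the free arc between the neighbouring ends
  -- joins `start` to `(𝕓 , false , false)`.
  slidePorts : Port → Port
  slidePorts = swap (𝕒 , false , true) (𝕓 , false , false) ∘ swap (𝕒 , false , false) (𝕓 , true , false)

start : Port
start = 𝕒 , false , false

walk : (ρ δ : Port → Port) → ℕ → Port → List Port
walk ρ δ zero    p = []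
walk ρ δ (suc k) p = p ∷ ρ p ∷ walk ρ δ k (δ (ρ p))

-- Four rounds list eight entries, as many as there are ports. A shorter cycle is run through
-- repeatedly; `Closed` certifies that nothing is missed.
orbit : (ρ δ : Port → Port) → List Port
orbit ρ δ = walk ρ δ 4 start

-- Opaque, lest the decision procedures be unfolded on an unknown ρ.
opaque
  Closed : (ρ δ : Port → Port) → Set
  Closed ρ δ = All (λ p → (ρ p ∈ˡ orbit ρ δ) × (δ p ∈ˡ orbit ρ δ)) (orbit ρ δ)

  closed? : ∀ ρ δ → Dec (Closed ρ δ)
  closed? ρ δ = all? (λ p → (ρ p ∈ˡ? orbit ρ δ) ×-dec (δ p ∈ˡ? orbit ρ δ)) (orbit ρ δ)

  Spans : (ρ δ : Port → Port) → Set
  Spans ρ δ = All (_∈ˡ orbit ρ δ) (allFlags 2)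

  spans? : ∀ ρ δ → Dec (Spans ρ δ)
  spans? ρ δ = all? (_∈ˡ? orbit ρ δ) (allFlags 2)

slid : Bool → Bool → Port → Port
slid α β = slidePorts ∘ follow (ends α β) ∘ slidePorts

record SlideRelationAt (ρ : Port → Port) (α β : Bool) : Set where
  constructor slides
  field
    closed      : Closed ρ (follow (ends α β))
    closed-slid : Closed ρ (slid α β)
    relation    : does (spans? ρ (slid α β)) ≡
      does (spans? ρ (follow (ends α β))) xor (α ∧ not β ∧ does (spans? ρ (follow (ends false true))))

slideRelationAt? : ∀ ρ α β → Dec (SlideRelationAt ρ α β)
slideRelationAt? ρ α β =
  map′ (λ (h , h′ , e) → slides h h′ e) (λ h → closed h , closed-slid h , relation h)
    (closed? ρ (follow (ends α β)) ×-dec closed? ρ (slid α β) ×-dec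
     (does (spans? ρ (slid α β)) Bool.≟
      does (spans? ρ (follow (ends α β))) xor (α ∧ not β ∧ does (spans? ρ (follow (ends false true))))))
  where open SlideRelationAt

record SlideRelation (ρ : Port → Port) : Set where
  constructor all-ends
  field at : All (λ α → All (SlideRelationAt ρ α) allBool) allBool

slideRelation? : ∀ ρ → Dec (SlideRelation ρ)
slideRelation? ρ = map′ all-ends SlideRelation.at (all? (λ α → all? (slideRelationAt? ρ α) allBool) allBool)

-- Enumeration of the matchings of the ports

Table : Set
Table = List (Port × Port)

value : Table → Port → Port
value []            p = p
value ((q , r) ∷ τ) p with p ≟ᶠ q
... | yes _ = r
... | no _  = value τ p

Compatible : Table → Port → Port → Set
Compatible τ p r = p ≢ r × All (λ (q , s) → (r ≡ q → s ≡ p) × (s ≡ p → r ≡ q)) τ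

compatible? : ∀ τ p r → Dec (Compatible τ p r)
compatible? τ p r = ¬? (p ≟ᶠ r) ×-dec
  all? (λ (q , s) → ((r ≟ᶠ q) →-dec (s ≟ᶠ p)) ×-dec ((s ≟ᶠ p) →-dec (r ≟ᶠ q))) τ

-- Quantifies over the values at ps of the fixed-point free involutions that extend τ,
-- discarding inconsistent partial assignments.
ForExtensions : (Table → Set) → List Port → Table → Set
ForExtensions P []       τ = P τ
ForExtensions P (p ∷ ps) τ = All (λ r → Compatible τ p r → ForExtensions P ps ((p , r) ∷ τ)) (allFlags 2)

forExtensions? : ∀ {P} → (∀ τ → Dec (P τ)) → ∀ ps τ → Dec (ForExtensions P ps τ)
forExtensions? P? []       τ = P? τ
forExtensions? P? (p ∷ ps) τ =
  all? (λ r → compatible? τ p r →-dec forExtensions? P? ps ((p , r) ∷ τ)) (allFlags 2)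

remaining : List Port
remaining = (𝕒 , false , true) ∷ (𝕒 , true , false) ∷ (𝕒 , true , true) ∷
            (𝕓 , false , true) ∷ (𝕓 , true , false) ∷ (𝕓 , true , true) ∷ []

-- The free arc between the neighbouring ends. The six ports in `remaining` then admit 5 · 3 · 1 =
-- 15 matchings.
initial : Table
initial = (start , (𝕓 , false , false)) ∷ ((𝕓 , false , false) , start) ∷ []

opaque
  unfolding slidePorts spans? closed?

  -- Evaluated for the fifteen matchings and the four values of `α` and `β`.
  slide-check : ForExtensions (SlideRelation ∘ value) remaining initial
  slide-check = toWitness {a? = forExtensions? (slideRelation? ∘ value) remaining initial} _

-- Contraction to the ends of two edges

Connected : {X : Set} → (X → X) → (X → X) → Set
Connected c d = ∀ p q → Reach c d p q

opaque
  unfolding Closed Spans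

  -- All entries of the orbit are reachable from `start`, and a closed list containing `start`
  -- contains all that is reachable from it.
  spans⇔connected : {ρ δ : Port → Port} → SelfInverse ρ → SelfInverse δ → Closed ρ δ → Spans ρ δ ⇔ Connected ρ δ
  spans⇔connected {ρ} {δ} ρρ δδ closed = mk⇔
    (λ spans p q → reach-sym ρρ δδ (walk-reach 4 (All.lookup spans (∈-allFlags p))) ◅◅
                   walk-reach 4 (All.lookup spans (∈-allFlags q)))
    (λ conn → All.tabulate λ {q} _ → reach-closed (_∈ˡ orbit ρ δ)
      (λ p p∈ → proj₁ (All.lookup closed p∈)) (λ p p∈ → proj₂ (All.lookup closed p∈))
      (conn start q) (here refl))
    where
    walk-reach : ∀ k {p q} → q ∈ˡ walk ρ δ k p → Reach ρ δ p q
    walk-reach (suc k) (here refl)         = ε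
    walk-reach (suc k) (there (here refl)) = c-step
    walk-reach (suc k) (there (there q∈))  = c-step ◅◅ (d-step ◅◅ walk-reach k q∈)

module _ (ρ : Port → Port) where

  Values : Table → Set
  Values = All (λ (p , r) → r ≡ ρ p)

  value-correct : ∀ τ → Values τ → ∀ p → p ∈ˡ map proj₁ τ → value τ p ≡ ρ p
  value-correct ((q , r) ∷ τ) (e ∷ vs) p p∈ with p ≟ᶠ q
  ... | yes refl = e
  value-correct (_ ∷ τ) (e ∷ vs) p (here p≡q)  | no p≢q = contradiction p≡q p≢q
  value-correct (_ ∷ τ) (e ∷ vs) p (there p∈) | no p≢q = value-correct τ vs p p∈

  module _ {P : Table → Set} (ρρ : SelfInverse ρ) (ρ-fixfree : ∀ p → ρ p ≢ p) where

    -- Follows the branch of the enumeration in which every port takes its value under `ρ`.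
    extension : ∀ ps τ → Values τ → ForExtensions P ps τ → (∀ p → p ∈ˡ ps ⊎ p ∈ˡ map proj₁ τ) →
                ∃ λ τ′ → (∀ p → value τ′ p ≡ ρ p) × P τ′
    extension []       τ vs h dom = τ , (λ p → value-correct τ vs p (in-table (dom p))) , h
      where
      in-table : ∀ {p} → p ∈ˡ [] ⊎ p ∈ˡ map proj₁ τ → p ∈ˡ map proj₁ τ
      in-table (inj₂ p∈) = p∈
    extension (p ∷ ps) τ vs h dom = extension ps ((p , ρ p) ∷ τ) (refl ∷ vs)
      (All.lookup h (∈-allFlags (ρ p)) (≢-sym (ρ-fixfree p) , All.map compatible vs))
      (λ q → move (dom q))
      where
      compatible : ∀ {(q , s) : Port × Port} → s ≡ ρ q → (ρ p ≡ q → s ≡ p) × (s ≡ p → ρ p ≡ q)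
      compatible refl = (λ e → trans (cong ρ (sym e)) (ρρ p)) , (λ e → trans (cong ρ (sym e)) (ρρ _))

      move : ∀ {q} → q ∈ˡ p ∷ ps ⊎ q ∈ˡ map proj₁ τ → q ∈ˡ ps ⊎ q ∈ˡ p ∷ map proj₁ τ
      move (inj₁ (here e))   = inj₂ (here e)
      move (inj₁ (there q∈)) = inj₁ q∈
      move (inj₂ q∈)         = inj₂ (there q∈)

abstract
  matching-slides : (ρ : Port → Port) → SelfInverse ρ → (∀ p → ρ p ≢ p) → ρ start ≡ (𝕓 , false , false) →
                    ∃ λ τ → (∀ p → value τ p ≡ ρ p) × SlideRelation (value τ)
  matching-slides ρ ρρ ρ-fixfree e =
    extension ρ {SlideRelation ∘ value} ρρ ρ-fixfree remaining initial
      (sym e ∷ sym (trans (cong ρ (sym e)) (ρρ start)) ∷ []) slide-check everywhere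
    where
    everywhere : ∀ p → p ∈ˡ remaining ⊎ p ∈ˡ map proj₁ initial
    everywhere (𝕒 , false , false) = inj₂ (here refl)
    everywhere (𝕓 , false , false) = inj₂ (there (here refl))
    everywhere (𝕒 , false , true)  = inj₁ (here refl)
    everywhere (𝕒 , true , false)  = inj₁ (there (here refl))
    everywhere (𝕒 , true , true)   = inj₁ (there (there (here refl)))
    everywhere (𝕓 , false , true)  = inj₁ (there (there (there (here refl))))
    everywhere (𝕓 , true , false)  = inj₁ (there (there (there (there (here refl)))))
    everywhere (𝕓 , true , true)   = inj₁ (there (there (there (there (there (here refl))))))

-- Paths of (c , d₀) that end at fixed points ι k of d₀ are contracted to edges of ρ.
module Contraction {X P : Set} {c d₀ : X → X} (cc : SelfInverse c) (dd₀ : SelfInverse d₀)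
                   (ι : P → X) (d₀-ι : ∀ k → d₀ (ι k) ≡ ι k)
                   (ρ : P → P) (ι-ρ : ∀ k → Reach c d₀ (ι k) (ι (ρ k)))
                   (ρ-only : ∀ {k l} → Reach c d₀ (ι k) (ι l) → l ≡ k ⊎ l ≡ ρ k) where

  -- Excludes boundary components that avoid the ports. Only `d₀` enters, so the condition is shared
  -- by all `d` that differ from `d₀` only at the ports.
  MeetsPorts : Set
  MeetsPorts = ∀ p → ∃ λ k → Reach c d₀ p (ι k)

  module _ (d : X → X) (δ : P → P) (split : ∀ p → (∃ λ k → p ≡ ι k) ⊎ d p ≡ d₀ p)
           (d-ι : ∀ k → d (ι k) ≡ ι (δ k)) where

    private
      d₀⇒d : ∀ {p q} → Reach c d₀ p q → Reach c d p q
      d₀⇒d = reach-map (λ p → p) (λ _ → c-step) step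
        where
        step : ∀ p → Reach c d p (d₀ p)
        step p with split p
        ... | inj₁ (k , refl) = subst (Reach c d (ι k)) (sym (d₀-ι k)) ε
        ... | inj₂ e          = inj₂ (sym e) ◅ ε

      expand : ∀ {k l} → Reach ρ δ k l → Reach c d (ι k) (ι l)
      expand = reach-map ι (d₀⇒d ∘ ι-ρ) (λ k → inj₂ (sym (d-ι k)) ◅ ε)

      meets : ∀ {p k} → Reach c d p (ι k) → ∃ λ l → Reach c d₀ p (ι l)
      meets ε = _ , ε
      meets {p} (inj₁ refl ◅ s) with meets s
      ... | l , t = l , c-step ◅◅ t
      meets {p} (inj₂ refl ◅ s) with split p
      ... | inj₁ (k , refl) = k , ε
      ... | inj₂ e with meets s
      ... | l , t = l , inj₂ e ◅ t

      -- The first argument is the stretch since the last port `ι m`. When it arrives at a port it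
      -- counts as an empty path or one `ρ`-step, and a new stretch begins.
      contract : ∀ {p m l} → Reach c d₀ (ι m) p → Reach c d p (ι l) → Reach ρ δ m l
      contract {m = m} t ε with ρ-only t
      ... | inj₁ refl = ε
      ... | inj₂ refl = c-step
      contract t (inj₁ refl ◅ s) = contract (t ◅◅ c-step) s
      contract {p} t (inj₂ refl ◅ s) with split p
      ... | inj₂ e = contract (t ◅◅ inj₂ e ◅ ε) s
      ... | inj₁ (k , refl) with contract {m = δ k} (subst (Reach c d₀ (ι (δ k))) (sym (d-ι k)) ε) s | ρ-only t
      ... | u | inj₁ refl = d-step ◅◅ u
      ... | u | inj₂ refl = c-step ◅◅ d-step ◅◅ u

    connected⇔ : SelfInverse d → P → Connected c d ⇔ (MeetsPorts × Connected ρ δ)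
    connected⇔ dd k₀ = mk⇔ to from
      where
      to : Connected c d → MeetsPorts × Connected ρ δ
      to conn = (λ p → meets (conn p (ι k₀))) , λ k l → contract ε (conn (ι k) (ι l))

      from : MeetsPorts × Connected ρ δ → Connected c d
      from (meet , conn) p q with meet p | meet q
      ... | k , s | l , t = d₀⇒d s ◅◅ expand (conn k l) ◅◅ reach-sym cc dd (d₀⇒d t)

-- Sliding one of two edges in a larger graph

xor-cancelʳ : ∀ x y → (x xor y) xor y ≡ x
xor-cancelʳ x y = trans (Bool.xor-assoc x y y) (trans (cong (x xor_) (Bool.xor-same y)) (Bool.xor-identityʳ x))

xor-injectiveʳ : ∀ y {x x′} → x xor y ≡ x′ xor y → x ≡ x′
xor-injectiveʳ y e = trans (sym (xor-cancelʳ _ y)) (trans (cong (_xor y) e) (xor-cancelʳ _ y))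

-- Carries the regluing from `c` over to `d`, where it affects only the ports, so that the paths
-- between ports stay as they were.
conjugate⇔ : {X : Set} {π : X → X} → SelfInverse π → (c d : X → X) →
             Connected (π ∘ c ∘ π) d ⇔ Connected c (π ∘ d ∘ π)
conjugate⇔ {π = π} ππ c d = mk⇔
  (λ conn p q → back (reach-map π
    (λ x → inj₁ (ππ (c (π x))) ◅ ε)
    (λ x → inj₂ (cong (π ∘ d) (sym (ππ x))) ◅ ε)
    (conn (π p) (π q))))
  (λ conn p q → back (reach-map π
    (λ x → inj₁ (cong (π ∘ c) (sym (ππ x))) ◅ ε)
    (λ x → inj₂ (ππ (d (π x))) ◅ ε)
    (conn (π p) (π q))))
  where
  back : ∀ {c d p q} → Reach c d (π (π p)) (π (π q)) → Reach c d p q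
  back {c} {d} {p} {q} h = subst (λ x → Reach c d x q) (ππ p) (subst (Reach c d _) (ππ q) h)

conjugate-involutive : {X : Set} (π f : X → X) → SelfInverse π → SelfInverse f → SelfInverse (π ∘ f ∘ π)
conjugate-involutive π f ππ ff x =
  trans (cong (π ∘ f) (ππ (f (π x)))) (trans (cong π (ff (π x))) (ππ x))

opaque
  unfolding slidePorts

  slidePorts-involutive : SelfInverse slidePorts
  slidePorts-involutive (𝕒 , false , false) = refl
  slidePorts-involutive (𝕒 , false , true)  = refl
  slidePorts-involutive (𝕒 , true , false)  = refl
  slidePorts-involutive (𝕒 , true , true)   = refl
  slidePorts-involutive (𝕓 , false , false) = refl
  slidePorts-involutive (𝕓 , false , true)  = refl
  slidePorts-involutive (𝕓 , true , false)  = refl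
  slidePorts-involutive (𝕓 , true , true)   = refl

module Placement {n} (a b : Fin n) (a≢b : a ≢ b) (i s j t : Bool) where

  -- If dual, ends and sides of b are interchanged: an exchange of ends is a slide in
  -- the partial dual with respect to b.
  place : (dual : Bool) → Port → Flag n
  place dual  (𝕒 , x , y) = a , x xor i , y xor s
  place false (𝕓 , x , y) = b , x xor j , y xor t
  place true  (𝕓 , x , y) = b , y xor j , x xor t

  -- Interchanging ends and sides of `b` turns `alongSide` into `acrossEnd` there, so the partial
  -- dual negates membership of `b`.
  portEnds : (dual : Bool) → Subset n → Subset 2
  portEnds dual φ = ends (lookup φ a) (dual xor lookup φ b)

  place-follow : ∀ dual φ k → follow φ (place dual k) ≡ place dual (follow (portEnds dual φ) k)
  place-follow dual φ (𝕒 , x , y) with lookup φ a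
  ... | true  = cong (λ z → a , z , y xor s) (Bool.not-distribˡ-xor x i)
  ... | false = cong (λ z → a , x xor i , z) (Bool.not-distribˡ-xor y s)
  place-follow true φ (𝕓 , x , y) with lookup φ b
  ... | true  = cong (λ z → b , z , x xor t) (Bool.not-distribˡ-xor y j)
  ... | false = cong (λ z → b , y xor j , z) (Bool.not-distribˡ-xor x t)
  place-follow false φ (𝕓 , x , y) with lookup φ b
  ... | true  = cong (λ z → b , z , y xor t) (Bool.not-distribˡ-xor x j)
  ... | false = cong (λ z → b , x xor j , z) (Bool.not-distribˡ-xor y t)

  K : Fin n → Bool
  K e = only a e ∨ only b e

  K-a : K a ≡ true
  K-a = cong (_∨ only b a) (only-self a)

  K-b : K b ≡ true
  K-b = trans (cong (only a b ∨_) (only-self b)) (Bool.∨-zeroʳ _)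

  K-place : ∀ dual k → K (edge (place dual k)) ≡ true
  K-place dual  (𝕒 , x , y) = K-a
  K-place true  (𝕓 , x , y) = K-b
  K-place false (𝕓 , x , y) = K-b

  place-onto : ∀ dual p → K (edge p) ≡ true → ∃ λ k → p ≡ place dual k
  place-onto dual (e , x , y) K-e with e Fin.≟ a
  ... | yes refl = (𝕒 , x xor i , y xor s) ,
    sym (cong₂ (λ u v → a , u , v) (xor-cancelʳ x i) (xor-cancelʳ y s))
  place-onto dual (e , x , y) K-e | no _ with e Fin.≟ b
  place-onto true  (e , x , y) K-e | no _ | yes refl = (𝕓 , y xor t , x xor j) ,
    sym (cong₂ (λ u v → b , u , v) (xor-cancelʳ x j) (xor-cancelʳ y t))
  place-onto false (e , x , y) K-e | no _ | yes refl = (𝕓 , x xor j , y xor t) ,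
    sym (cong₂ (λ u v → b , u , v) (xor-cancelʳ x j) (xor-cancelʳ y t))

  place-injective : ∀ dual {k l} → place dual k ≡ place dual l → k ≡ l
  place-injective dual {𝕒 , x , y} {𝕒 , x′ , y′} e = cong₂ (λ u v → 𝕒 , u , v)
    (xor-injectiveʳ i (cong (proj₁ ∘ proj₂) e)) (xor-injectiveʳ s (cong (proj₂ ∘ proj₂) e))
  place-injective true  {𝕒 , _} {𝕓 , _} e = contradiction (cong proj₁ e) a≢b
  place-injective false {𝕒 , _} {𝕓 , _} e = contradiction (cong proj₁ e) a≢b
  place-injective true  {𝕓 , _} {𝕒 , _} e = contradiction (cong proj₁ (sym e)) a≢b
  place-injective false {𝕓 , _} {𝕒 , _} e = contradiction (cong proj₁ (sym e)) a≢b
  place-injective true  {𝕓 , x , y} {𝕓 , x′ , y′} e = cong₂ (λ u v → 𝕓 , u , v)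
    (xor-injectiveʳ t (cong (proj₂ ∘ proj₂) e)) (xor-injectiveʳ j (cong (proj₁ ∘ proj₂) e))
  place-injective false {𝕓 , x , y} {𝕓 , x′ , y′} e = cong₂ (λ u v → 𝕓 , u , v)
    (xor-injectiveʳ j (cong (proj₁ ∘ proj₂) e)) (xor-injectiveʳ t (cong (proj₂ ∘ proj₂) e))

module Ports {n} (a b : Fin n) (a≢b : a ≢ b) (i s j t dual : Bool) where

  open Placement a b a≢b i s j t public using (K)
  private module P = Placement a b a≢b i s j t

  ι : Port → Flag n
  ι = P.place dual

  portEnds : Subset n → Subset 2
  portEnds = P.portEnds dual

  ι-follow : ∀ φ k → follow φ (ι k) ≡ ι (follow (portEnds φ) k)
  ι-follow = P.place-follow dual

  K-ι : ∀ k → K (edge (ι k)) ≡ true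
  K-ι = P.K-place dual

  ι-onto : ∀ p → K (edge p) ≡ true → ∃ λ k → p ≡ ι k
  ι-onto = P.place-onto dual

  ι-injective : ∀ {k l} → ι k ≡ ι l → k ≡ l
  ι-injective = P.place-injective dual

  swap-ι : ∀ k l m → swap (ι k) (ι l) (ι m) ≡ ι (swap k l m)
  swap-ι k l m with m ≟ᶠ k
  ... | yes refl = swap-left (ι k) (ι l)
  ... | no m≢k with m ≟ᶠ l
  ... | yes refl = swap-right (ι k) (ι l)
  ... | no m≢l   = swap-other (ι k) (ι l) (m≢k ∘ ι-injective) (m≢l ∘ ι-injective)

  off-ports : ∀ p → K (edge p) ≡ false → ∀ k → p ≢ ι k
  off-ports p K-p k refl with trans (sym (K-ι k)) K-p
  ... | ()

  opaque
    unfolding slidePorts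

    -- Unfolds to the regluing of `handleSlide` if `dual` is false, and to that of `exchangeEnds` if
    -- it is true.
    π : Flag n → Flag n
    π = swap (ι (𝕒 , false , true)) (ι (𝕓 , false , false)) ∘ swap (ι (𝕒 , false , false)) (ι (𝕓 , true , false))

    π-ι : ∀ k → π (ι k) ≡ ι (slidePorts k)
    π-ι k = trans
      (cong (swap (ι (𝕒 , false , true)) (ι (𝕓 , false , false))) (swap-ι (𝕒 , false , false) (𝕓 , true , false) k))
      (swap-ι (𝕒 , false , true) (𝕓 , false , false) (swap (𝕒 , false , false) (𝕓 , true , false) k))

    π-off : ∀ p → K (edge p) ≡ false → π p ≡ p
    π-off p K-p = trans
      (cong (swap (ι (𝕒 , false , true)) (ι (𝕓 , false , false)))
        (swap-other (ι (𝕒 , false , false)) (ι (𝕓 , true , false)) (off-ports p K-p (𝕒 , false , false)) (off-ports p K-p (𝕓 , true , false))))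
      (swap-other (ι (𝕒 , false , true)) (ι (𝕓 , false , false)) (off-ports p K-p (𝕒 , false , true)) (off-ports p K-p (𝕓 , false , false)))

  on-off : ∀ p → (∃ λ k → p ≡ ι k) ⊎ K (edge p) ≡ false
  on-off p with K (edge p) in eq
  ... | true  = inj₁ (ι-onto p eq)
  ... | false = inj₂ refl

  π-involutive : SelfInverse π
  π-involutive p = case (on-off p)
    where
    case : (∃ λ k → p ≡ ι k) ⊎ K (edge p) ≡ false → π (π p) ≡ p
    case (inj₁ (k , e)) = subst (λ q → π (π q) ≡ q) (sym e)
      (trans (cong π (π-ι k)) (trans (π-ι (slidePorts k)) (cong ι (slidePorts-involutive k))))
    case (inj₂ off)     = trans (cong π (π-off p off)) (π-off p off)

  module _ {c : Flag n → Flag n} (cc : SelfInverse c) (c-fixfree : ∀ p → c p ≢ p)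
           (arc : c (ι start) ≡ ι (𝕓 , false , false)) (φ : Subset n) where

    private
      d₀ : Flag n → Flag n
      d₀ = cut K (follow φ)

      dd₀ : SelfInverse d₀
      dd₀ = cut-involutive K φ

      d₀-ι : ∀ k → d₀ (ι k) ≡ ι k
      d₀-ι k = cut-on K φ (ι k) (K-ι k)

      module W = FlagWalk cc c-fixfree K φ

      partner : ∀ k → W.Partner (ι k)
      partner k = W.partner (d₀-ι k)

      abstract
        partner-port : ∀ k → ∃ λ l → W.Partner.end (partner k) ≡ ι l
        partner-port k = ι-onto _ (cut-fixed K φ _ (W.Partner.end-fixed (partner k)))

      -- The matching of the eight flags of `a` and `b` by the boundary paths outside these two
      -- ribbons.
      ρ : Port → Port
      ρ k = proj₁ (partner-port k)

      ι-ρ : ∀ k → Reach c d₀ (ι k) (ι (ρ k))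
      ι-ρ k = subst (Reach c d₀ (ι k)) (proj₂ (partner-port k)) (W.Partner.reachable (partner k))

      ρ-only : ∀ {k l} → Reach c d₀ (ι k) (ι l) → l ≡ k ⊎ l ≡ ρ k
      ρ-only {k} {l} h with W.Partner.only (partner k) h (d₀-ι l)
      ... | inj₁ e = inj₁ (ι-injective e)
      ... | inj₂ e = inj₂ (ι-injective (trans e (proj₂ (partner-port k))))

      ρ-fixfree : ∀ k → ρ k ≢ k
      ρ-fixfree k e = W.Partner.end≢ (partner k) (trans (proj₂ (partner-port k)) (cong ι e))

      ρρ : SelfInverse ρ
      ρρ k with ρ-only (reach-sym cc dd₀ (ι-ρ k))
      ... | inj₁ e = contradiction (sym e) (ρ-fixfree k)
      ... | inj₂ e = sym e

      ρ-start : ρ start ≡ (𝕓 , false , false)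
      ρ-start with ρ-only {start} {𝕓 , false , false} (inj₁ (sym arc) ◅ ε)
      ... | inj₂ e = sym e

    module _ (φ₀₁ : Subset n) (agree : ∀ e → K e ≡ false → lookup φ₀₁ e ≡ lookup φ e)
             (φ₀₁-ends : portEnds φ₀₁ ≡ ends false true) where

      private
        α β : Bool
        α = lookup φ a
        β = dual xor lookup φ b

        module Contracted (ρ′ : Port → Port) (ρ′≗ρ : ∀ k → ρ′ k ≡ ρ k) where

          open Contraction cc dd₀ ι d₀-ι ρ′
            (λ k → subst (λ l → Reach c d₀ (ι k) (ι l)) (sym (ρ′≗ρ k)) (ι-ρ k))
            (λ {k} {l} h → subst (λ m → l ≡ k ⊎ l ≡ m) (sym (ρ′≗ρ k)) (ρ-only h)) public

          ρ′ρ′ : SelfInverse ρ′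
          ρ′ρ′ k = trans (ρ′≗ρ _) (trans (cong ρ (ρ′≗ρ k)) (ρρ k))

          meetsPorts? : Dec MeetsPorts
          meetsPorts? = allFlag? λ p →
            map′ (λ h → proj₁ (find h) , proj₂ (proj₂ (find h))) (λ (k , h) → lose (∈-allFlags k) h)
              (any? (λ k → reach? c d₀ p (ι k)) (allFlags 2))

          connected⇔spans : ∀ d δ → SelfInverse d → SelfInverse δ → Closed ρ′ δ →
                            (∀ p → K (edge p) ≡ false → d p ≡ follow φ p) → (∀ k → d (ι k) ≡ ι (δ k)) →
                            Connected c d ⇔ (MeetsPorts × Spans ρ′ δ)
          connected⇔spans d δ dd δδ closed d-off d-ι = mk⇔
            (λ h → proj₁ (C.to h) , S.from (proj₂ (C.to h)))
            (λ (h , h′) → C.from (h , S.to h′))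
            where
            split : ∀ p → (∃ λ k → p ≡ ι k) ⊎ d p ≡ d₀ p
            split p with on-off p
            ... | inj₁ h   = inj₁ h
            ... | inj₂ off = inj₂ (trans (d-off p off) (sym (cut-off K φ p off)))
            module C = Equivalence (connected⇔ d δ split d-ι dd start)
            module S = Equivalence (spans⇔connected ρ′ρ′ δδ closed)

      abstract
        -- After conjugation the three boundaries have the same paths between ports, hence the same
        -- matching and the same `MeetsPorts`. What remains is the relation checked for every
        -- matching.
        connected-slide : (X? : Dec (Connected (π ∘ c ∘ π) (follow φ)))
                          (Y? : Dec (Connected c (follow φ))) (Z? : Dec (Connected c (follow φ₀₁))) →
                          does X? ≡ does Y? xor (α ∧ not β ∧ does Z?)
        connected-slide X? Y? Z? = from-matching (matching-slides ρ ρρ ρ-fixfree ρ-start)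
          where
          from-matching : (∃ λ τ → (∀ k → value τ k ≡ ρ k) × SlideRelation (value τ)) →
                          does X? ≡ does Y? xor (α ∧ not β ∧ does Z?)
          from-matching (τ , τ≗ρ , rel) = begin
            does X?
              ≡⟨ does-⇔ X⇔ X? (M? ×-dec spans? ρ′ (slid α β)) ⟩
            does M? ∧ does (spans? ρ′ (slid α β))
              ≡⟨ cong (does M? ∧_) (relation (rel-at α β)) ⟩
            does M? ∧ (does Sy? xor (α ∧ not β ∧ does Sz?))
              ≡⟨ distribute (does M?) ⟩
            (does M? ∧ does Sy?) xor (α ∧ not β ∧ (does M? ∧ does Sz?))
              ≡⟨ cong₂ (λ y z → y xor (α ∧ not β ∧ z)) (does-⇔ Y⇔ Y? (M? ×-dec Sy?)) (does-⇔ Z⇔ Z? (M? ×-dec Sz?)) ⟨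
            does Y? xor (α ∧ not β ∧ does Z?) ∎
            where
            open ≡-Reasoning
            open SlideRelationAt

            ρ′ : Port → Port
            ρ′ = value τ

            module C = Contracted ρ′ τ≗ρ

            M? : Dec C.MeetsPorts
            M? = C.meetsPorts?

            Sy? : Dec (Spans ρ′ (follow (ends α β)))
            Sy? = spans? ρ′ (follow (ends α β))

            Sz? : Dec (Spans ρ′ (follow (ends false true)))
            Sz? = spans? ρ′ (follow (ends false true))

            rel-at : ∀ α β → SlideRelationAt ρ′ α β
            rel-at α β = All.lookup (All.lookup (SlideRelation.at rel) (∈-allBool α)) (∈-allBool β)

            distribute : ∀ m {y z} → m ∧ (y xor (α ∧ not β ∧ z)) ≡ (m ∧ y) xor (α ∧ not β ∧ (m ∧ z))
            distribute true  = refl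
            distribute false = sym (trans (cong (α ∧_) (Bool.∧-zeroʳ (not β))) (Bool.∧-zeroʳ α))

            d-π : Flag n → Flag n
            d-π = π ∘ follow φ ∘ π

            d-π-off : ∀ p → K (edge p) ≡ false → d-π p ≡ follow φ p
            d-π-off p off = trans (cong (π ∘ follow φ) (π-off p off))
              (π-off (follow φ p) (trans (cong K (follow-edge φ p)) off))

            d-π-ι : ∀ k → d-π (ι k) ≡ ι (slid α β k)
            d-π-ι k = trans (cong (π ∘ follow φ) (π-ι k))
              (trans (cong π (ι-follow φ (slidePorts k))) (π-ι (follow (ends α β) (slidePorts k))))

            X⇔ : Connected (π ∘ c ∘ π) (follow φ) ⇔ (C.MeetsPorts × Spans ρ′ (slid α β))
            X⇔ = C.connected⇔spans d-π (slid α β)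
                   (conjugate-involutive π (follow φ) π-involutive (follow-involutive φ))
                   (conjugate-involutive slidePorts (follow (ends α β)) slidePorts-involutive (follow-involutive (ends α β)))
                   (closed-slid (rel-at α β)) d-π-off d-π-ι
                 ⇔-∘ conjugate⇔ {π = π} π-involutive c (follow φ)

            Y⇔ : Connected c (follow φ) ⇔ (C.MeetsPorts × Spans ρ′ (follow (ends α β)))
            Y⇔ = C.connected⇔spans (follow φ) (follow (ends α β)) (follow-involutive φ) (follow-involutive (ends α β))
                   (closed (rel-at α β)) (λ _ _ → refl) (ι-follow φ)

            Z⇔ : Connected c (follow φ₀₁) ⇔ (C.MeetsPorts × Spans ρ′ (follow (ends false true)))
            Z⇔ = C.connected⇔spans (follow φ₀₁) (follow (ends false true)) (follow-involutive φ₀₁) (follow-involutive (ends false true))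
                   (closed (rel-at false true))
                   (λ p off → follow-cong φ₀₁ φ p (agree (edge p) off))
                   (λ k → trans (ι-follow φ₀₁ k) (cong (λ e → ι (follow e k)) φ₀₁-ends))

-- The delta-matroids of the Vassiliev moves

module _ {a b e : Fin n} (off : only a e ∨ only b e ≡ false) where

  off-left : e ≢ a
  off-left e≡a with trans (sym off) (cong (_∨ only b e) (dec-true (e Fin.≟ a) e≡a))
  ... | ()

  off-right : e ≢ b
  off-right e≡b with trans (sym off) (trans (cong (only a e ∨_) (dec-true (e Fin.≟ b) e≡b)) (Bool.∨-zeroʳ _))
  ... | ()

lookup-⁅⁆-self : (b : Fin n) → lookup ⁅ b ⁆ b ≡ true
lookup-⁅⁆-self b = []=⇒lookup (x∈⁅x⁆ b)

lookup-⁅⁆-other : {b e : Fin n} → e ≢ b → lookup ⁅ b ⁆ e ≡ false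
lookup-⁅⁆-other {b = b} {e} e≢b with lookup ⁅ b ⁆ e in eq
... | false = refl
... | true  = contradiction (x∈⁅y⁆⇒x≡y b (lookup⇒[]= e ⁅ b ⁆ eq)) e≢b

module _ (φ : Subset n) {b : Fin n} where

  lookup-twisted : ∀ {e} → e ≢ b → lookup (φ △ ⁅ b ⁆) e ≡ lookup φ e
  lookup-twisted {e} e≢b = trans (lookup-zipWith _xor_ e φ ⁅ b ⁆)
    (trans (cong (lookup φ e xor_) (lookup-⁅⁆-other e≢b)) (Bool.xor-identityʳ _))

  lookup-twisted-self : lookup (φ △ ⁅ b ⁆) b ≡ not (lookup φ b)
  lookup-twisted-self = trans (lookup-zipWith _xor_ b φ ⁅ b ⁆)
    (trans (cong (lookup φ b xor_) (lookup-⁅⁆-self b)) (Bool.xor-comm (lookup φ b) true))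

△-cancelʳ : (φ ψ : Subset n) → (φ △ ψ) △ ψ ≡ φ
△-cancelʳ φ ψ = subset-ext λ e → trans (lookup-zipWith _xor_ e (φ △ ψ) ψ)
  (trans (cong (_xor lookup ψ e) (lookup-zipWith _xor_ e φ ψ)) (xor-cancelʳ (lookup φ e) (lookup ψ e)))

module _ {a b : Fin n} (a≢b : a ≢ b) (φ : Subset n) where

  replaced : Subset n
  replaced = φ [ a ]≔ outside [ b ]≔ inside

  lookup-replaced : ∀ {e} → e ≢ a → e ≢ b → lookup replaced e ≡ lookup φ e
  lookup-replaced e≢a e≢b = trans (lookup∘update′ e≢b (φ [ a ]≔ outside) inside) (lookup∘update′ e≢a φ outside)

  lookup-replaced-left : lookup replaced a ≡ false
  lookup-replaced-left = trans (lookup∘update′ a≢b (φ [ a ]≔ outside) inside) (lookup∘update a φ outside)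

  lookup-replaced-right : lookup replaced b ≡ true
  lookup-replaced-right = lookup∘update b (φ [ a ]≔ outside) inside

module _ {a b : Fin n} (a≢b : a ≢ b) (φ : Subset n) where

  -- The set tested by the correction term of `exchange`: between the two twists `b` is inserted, so
  -- twisting back removes it along with `a`.
  both-removed : Subset n
  both-removed = replaced a≢b (φ △ ⁅ b ⁆) △ ⁅ b ⁆

  lookup-both-removed : ∀ {e} → e ≢ a → e ≢ b → lookup both-removed e ≡ lookup φ e
  lookup-both-removed e≢a e≢b = trans (lookup-twisted (replaced a≢b (φ △ ⁅ b ⁆)) e≢b)
    (trans (lookup-replaced a≢b (φ △ ⁅ b ⁆) e≢a e≢b) (lookup-twisted φ e≢b))

  lookup-both-removed-left : lookup both-removed a ≡ false
  lookup-both-removed-left = trans (lookup-twisted (replaced a≢b (φ △ ⁅ b ⁆)) a≢b) (lookup-replaced-left a≢b (φ △ ⁅ b ⁆))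

  lookup-both-removed-right : lookup both-removed b ≡ false
  lookup-both-removed-right = trans (lookup-twisted-self (replaced a≢b (φ △ ⁅ b ⁆)))
    (cong not (lookup-replaced-right a≢b (φ △ ⁅ b ⁆)))

-- The double negation is kept to match `not β` in `connected-slide`, where `β` is already negated
-- by `dual`.
exchange-feasible : (D : SetSystem) {a b : Fin (size D)} (a≢b : a ≢ b) (φ : Subset (size D)) →
  feasible (exchange D a b) φ ≡
  feasible D φ xor (lookup φ a ∧ not (not (lookup φ b)) ∧ feasible D (both-removed a≢b φ))
exchange-feasible D {b = b} a≢b φ = cong₂ _xor_ (cong (feasible D) (△-cancelʳ φ ⁅ b ⁆))
  (cong₂ (λ x y → x ∧ not y ∧ feasible D (both-removed a≢b φ)) (lookup-twisted φ a≢b) (lookup-twisted-self φ))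

module _ (Γ : EmbeddedGraph) {a b : Fin (#edges Γ)} (a≢b : a ≢ b) (N : NeighbouringEnds Γ a b) where

  open NeighbouringEnds N

  opaque
    unfolding Ports.π hasConnectedBoundary

    handleSlide-feasible : ∀ φ → hasConnectedBoundary (handleSlide Γ a≢b N) φ ≡
      hasConnectedBoundary Γ φ xor (lookup φ a ∧ not (lookup φ b) ∧ hasConnectedBoundary Γ (replaced a≢b φ))
    handleSlide-feasible φ = P.connected-slide {c = corner Γ} (involutive Γ) (fixfree Γ) consecutive φ (replaced a≢b φ)
      (λ e off → lookup-replaced a≢b φ (off-left {a = a} {b} off) (off-right {a = a} {b} off))
      (cong₂ ends (lookup-replaced-left a≢b φ) (lookup-replaced-right a≢b φ))
      (connectedBoundary? (handleSlide Γ a≢b N) φ) (connectedBoundary? Γ φ) (connectedBoundary? Γ (replaced a≢b φ))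
      where module P = Ports a b a≢b endᵃ sideᵃ endᵇ sideᵇ false

    exchangeEnds-feasible : ∀ φ → hasConnectedBoundary (exchangeEnds Γ a≢b N) φ ≡
      hasConnectedBoundary Γ φ xor (lookup φ a ∧ not (not (lookup φ b)) ∧ hasConnectedBoundary Γ (both-removed a≢b φ))
    exchangeEnds-feasible φ = P.connected-slide {c = corner Γ} (involutive Γ) (fixfree Γ) consecutive φ (both-removed a≢b φ)
      (λ e off → lookup-both-removed a≢b φ (off-left {a = a} {b} off) (off-right {a = a} {b} off))
      (cong₂ (λ x y → ends x (not y)) (lookup-both-removed-left a≢b φ) (lookup-both-removed-right a≢b φ))
      (connectedBoundary? (exchangeEnds Γ a≢b N) φ) (connectedBoundary? Γ φ) (connectedBoundary? Γ (both-removed a≢b φ))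
      where module P = Ports a b a≢b endᵃ sideᵃ endᵇ sideᵇ true

  slide≅handleSlide : slide (ribbonSystem Γ) a b ≅ ribbonSystem (handleSlide Γ a≢b N)
  slide≅handleSlide = ≗⇒iso (feasible (slide (ribbonSystem Γ) a b)) (hasConnectedBoundary (handleSlide Γ a≢b N))
    λ φ → sym (handleSlide-feasible φ)

  exchange≅exchangeEnds : exchange (ribbonSystem Γ) a b ≅ ribbonSystem (exchangeEnds Γ a≢b N)
  exchange≅exchangeEnds = ≗⇒iso (feasible (exchange (ribbonSystem Γ) a b)) (hasConnectedBoundary (exchangeEnds Γ a≢b N))
    λ φ → trans (exchange-feasible (ribbonSystem Γ) a≢b φ) (sym (exchangeEnds-feasible φ))

module _ (Γ : EmbeddedGraph) {a b : Fin (#edges Γ)} (a≢b : a ≢ b) (N : NeighbouringEnds Γ a b) where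

  -- Both values of the slid system entering `exchange-feasible` are values for `handleSlide`, whose
  -- own exchange of ends then applies.
  exchange-slide≅ : exchange (slide (ribbonSystem Γ) a b) a b ≅
    ribbonSystem (exchangeEnds (handleSlide Γ a≢b N) a≢b (slidEnds Γ a≢b N))
  exchange-slide≅ = ≗⇒iso (feasible (exchange (slide (ribbonSystem Γ) a b) a b))
    (hasConnectedBoundary (exchangeEnds (handleSlide Γ a≢b N) a≢b (slidEnds Γ a≢b N)))
    λ φ → trans (exchange-feasible (slide (ribbonSystem Γ) a b) a≢b φ) (trans
      (cong₂ (λ x y → x xor (lookup φ a ∧ not (not (lookup φ b)) ∧ y))
        (sym (handleSlide-feasible Γ a≢b N φ)) (sym (handleSlide-feasible Γ a≢b N (both-removed a≢b φ))))
      (sym (exchangeEnds-feasible (handleSlide Γ a≢b N) a≢b (slidEnds Γ a≢b N) φ)))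

-- The four-term relation

≅-trans : (D D′ D″ : SetSystem) → D ≅ D′ → D′ ≅ D″ → D ≅ D″
≅-trans D D′ D″ (σ , iso) (τ , iso′) = σ Permutation.∘ₚ τ , λ φ → trans (iso′ φ) (trans (iso _)
  (cong (feasible D) (tabulate-cong λ e → lookup∘tabulate (λ e′ → lookup φ (τ ⟨$⟩ʳ e′)) (σ ⟨$⟩ʳ e))))

IsBinary-resp-≅ : (D D′ : SetSystem) → D ≅ D′ → IsBinary D′ → IsBinary D
IsBinary-resp-≅ D D′ (σ , iso) ((φ , φ∈) , H , A , iso′) =
  (Vec.tabulate (λ e → lookup φ (σ ⟨$⟩ʳ e)) , trans (sym (iso φ)) φ∈) , H , A ,
  ≅-trans D D′ (twist (nondegeneracy H) A) (σ , iso) iso′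

module _ {k ℓk v ℓv : Level} {K : CommutativeRing k ℓk} (V : Module K v ℓv) where

  open FourTerm V
  private module M = Module V

  four-term-resp-≅ : (f : BinaryDeltaMatroid → M.Carrierᴹ) → IsomorphismInvariant f → FourTermDM f →
    (D D′ D~ D~′ : SetSystem) (a b : Fin (size D)) → a ≢ b →
    exchange D a b ≅ D′ → slide D a b ≅ D~ → exchange (slide D a b) a b ≅ D~′ →
    (β : IsBinary D) (β′ : IsBinary D′) (β~ : IsBinary D~) (β~′ : IsBinary D~′) →
    f (D , β) -ᴹ f (D′ , β′) M.≈ᴹ f (D~ , β~) -ᴹ f (D~′ , β~′)
  four-term-resp-≅ f f-iso four-term D D′ D~ D~′ a b a≢b ≅′ ≅~ ≅~′ β β′ β~ β~′ =
    M.≈ᴹ-trans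
      (M.+ᴹ-congˡ (M.-ᴹ‿cong (M.≈ᴹ-sym (f-iso (exchange D a b , γ′) (D′ , β′) ≅′))))
      (M.≈ᴹ-trans (four-term D a b a≢b β γ′ γ~ γ~′)
        (M.+ᴹ-cong (f-iso (slide D a b , γ~) (D~ , β~) ≅~)
          (M.-ᴹ‿cong (f-iso (exchange (slide D a b) a b , γ~′) (D~′ , β~′) ≅~′))))
    where
    -- Binarity of the moved systems is pulled back along the isomorphisms, so closure of binary
    -- delta-matroids under the moves is not invoked.
    γ′ : IsBinary (exchange D a b)
    γ′ = IsBinary-resp-≅ _ D′ ≅′ β′

    γ~ : IsBinary (slide D a b)
    γ~ = IsBinary-resp-≅ _ D~ ≅~ β~

    γ~′ : IsBinary (exchange (slide D a b) a b)
    γ~′ = IsBinary-resp-≅ _ D~′ ≅~′ β~′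

  ribbonSystem-four-term : (f : BinaryDeltaMatroid → M.Carrierᴹ) → IsomorphismInvariant f → FourTermDM f →
                           FourTermEG (λ Γ → f (ribbonSystem Γ , ribbonSystem-binary Γ))
  ribbonSystem-four-term f f-iso four-term Γ a b a≢b N =
    let Γ′  = exchangeEnds Γ a≢b N
        Γ~  = handleSlide Γ a≢b N
        Γ~′ = exchangeEnds Γ~ a≢b (slidEnds Γ a≢b N)
    in four-term-resp-≅ f f-iso four-term (ribbonSystem Γ) (ribbonSystem Γ′) (ribbonSystem Γ~) (ribbonSystem Γ~′) a b a≢b
      (exchange≅exchangeEnds Γ a≢b N) (slide≅handleSlide Γ a≢b N) (exchange-slide≅ Γ a≢b N)
      (ribbonSystem-binary Γ) (ribbonSystem-binary Γ′) (ribbonSystem-binary Γ~) (ribbonSystem-binary Γ~′)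

  -- Serves to pass from the opaque `ribbonSystem` back to `deltaMatroid`.
  FourTermEG-resp-≗ : (g h : EmbeddedGraph → M.Carrierᴹ) → (∀ Γ → g Γ ≡ h Γ) → FourTermEG g → FourTermEG h
  FourTermEG-resp-≗ g h g≗h four-term Γ a b a≢b N = subst₂ M._≈ᴹ_
    (cong₂ _-ᴹ_ (g≗h Γ) (g≗h (exchangeEnds Γ a≢b N)))
    (cong₂ _-ᴹ_ (g≗h (handleSlide Γ a≢b N)) (g≗h (exchangeEnds (handleSlide Γ a≢b N) a≢b (slidEnds Γ a≢b N))))
    (four-term Γ a b a≢b N)

pair-subst : {D D′ : SetSystem} (e : D ≡ D′) (β : IsBinary D) → (D , β) ≡ (D′ , subst IsBinary e β)
pair-subst refl β = refl

theorem4p4 : {k ℓk v ℓv : Level} (K : CommutativeRing k ℓk) (V : Module K v ℓv) →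
    let open FourTerm V in
    (f : BinaryDeltaMatroid → Module.Carrierᴹ V) →
    IsomorphismInvariant f →
    FourTermDM f →
    Σ (∀ Γ → IsBinary (deltaMatroid Γ)) λ binary →
    FourTermEG (λ Γ → f (deltaMatroid Γ , binary Γ))
theorem4p4 K V f f-iso four-term = binary ,
  FourTermEG-resp-≗ V (λ Γ → f (ribbonSystem Γ , ribbonSystem-binary Γ)) (λ Γ → f (deltaMatroid Γ , binary Γ))
    (λ Γ → cong f (pair-subst (ribbonSystem≡deltaMatroid Γ) (ribbonSystem-binary Γ)))
    (ribbonSystem-four-term V f f-iso four-term)
  where
  binary : ∀ Γ → IsBinary (deltaMatroid Γ)
  binary Γ = subst IsBinary (ribbonSystem≡deltaMatroid Γ) (ribbonSystem-binary Γ)
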